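{- Let $M$ be an infinite (countably indexed) irreducible non-negative matrix with $\lambda(M)<\infty$. Assume that the digraph of $M$ admits a finite cycle transversal and that $\lambda(M)-\lambda_n(M)=o(n^{ -1})$ as $n\to\infty$. Then $M$ is recurrent.
   Context: The digraph of a matrix has the index-set as vertex-set, and $(v,w)$ is an arc if and only if the $(v,w)$ entry is non-zero (loops allowed). A matrix is irreducible if its digraph is strongly connected, i.e. for any two distinct vertices $v,w$ there is a directed path from $v$ to $w$. A cycle transversal of a digraph is a set of vertices whose deletion (with all incident arcs) leaves a digraph with no directed cycles (loops count as cycles of length 1, pairs of opposite arcs as cycles of length 2). For an infinite entrywise non-negative matrix $M$, $\lambda_n(M)$ is the supremum of the spectral radii of its principal submatrices of order $n$, and $\lambda(M)=\lim_{n\to\infty}\lambda_n(M)$, i.e. the supremum of the spectral radii of all finite principal submatrices. $M$ with $\lambda(M)<\infty$ is transient if the series $\sum_{p=0}^{\infty}M^pz^{ -p}$ converges entrywise at $z=\lambda(M)$ (it always converges for $z>\lambda(M)$), and recurrent otherwise. -}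

module Defs where

open import Algebra.Bundles using (CommutativeRing; Semiring)
open import Algebra.Structures using (IsCommutativeRing)
import Algebra.Definitions.RawSemiring as RawSemiringDefinitions
open import Data.Fin using (Fin; zero; suc; toℕ; fromℕ; inject₁)
import Data.Fin as Fin
open import Data.List using (List)
open import Data.List.Membership.Propositional using (_∉_)
open import Data.Nat using (ℕ; zero; suc; NonZero)
import Data.Nat as ℕ
open import Data.Nat.Properties using (_≟_)
open import Data.Product using (∃; ∃-syntax; Σ-syntax; _×_)
open import Data.Vec.Functional using (Vector; foldr)
open import Function using (Injective)
open import Level using (0ℓ)
open import Relation.Binary using (Rel; IsTotalOrder)
open import Relation.Binary.Construct.Closure.ReflexiveTransitive using (Star)
import Relation.Binary.Construct.NonStrictToStrict as NonStrictToStrict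
open import Relation.Binary.PropositionalEquality using (_≡_; _≢_)
open import Relation.Nullary using (¬_; yes; no)
open import Relation.Unary using (Pred)

-- The real numbers, given axiomatically as a Dedekind-complete totally
-- ordered field.  In the presence of excluded middle such a structure
-- exists and is unique up to isomorphism.
record Reals : Set₁ where
  infix  4 _≈_ _≤_
  infixl 6 _+_
  infixl 7 _*_
  infix  8 -_
  field
    Carrier : Set
    _≈_ _≤_ : Rel Carrier 0ℓ
    _+_ _*_ : Carrier → Carrier → Carrier
    -_      : Carrier → Carrier
    0# 1#   : Carrier
    isCommutativeRing : IsCommutativeRing _≈_ _+_ _*_ -_ 0# 1#
    isTotalOrder      : IsTotalOrder _≈_ _≤_
    0≉1      : ¬ (0# ≈ 1#)
    inverse  : ∀ x → ¬ (x ≈ 0#) → ∃[ y ] x * y ≈ 1#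
    +-monoˡ-≤ : ∀ z {x y} → x ≤ y → x + z ≤ y + z
    *-nonNeg  : ∀ {x y} → 0# ≤ x → 0# ≤ y → 0# ≤ x * y

  UpperBound : Pred Carrier 0ℓ → Carrier → Set
  UpperBound P b = ∀ x → P x → x ≤ b

  IsSupremum : Pred Carrier 0ℓ → Carrier → Set
  IsSupremum P s = UpperBound P s × (∀ b → UpperBound P b → s ≤ b)

  IsMaximum : Pred Carrier 0ℓ → Carrier → Set
  IsMaximum P m = P m × UpperBound P m

  field
    complete : (P : Pred Carrier 0ℓ) → ∃ P → ∃ (UpperBound P) → ∃ (IsSupremum P)

  commutativeRing : CommutativeRing 0ℓ 0ℓ
  commutativeRing = record { isCommutativeRing = isCommutativeRing }

  open CommutativeRing commutativeRing public
    using (_-_; semiring)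

  open NonStrictToStrict _≈_ _≤_ public using (_<_)

module Digraph where

  -- Directed cycles of length k + 1, with pairwise distinct vertices;
  -- k = 0 is a loop and k = 1 is a pair of opposite arcs.
  record Cycle (E : Rel ℕ 0ℓ) : Set where
    field
      {k}      : ℕ
      vertex   : Fin (suc k) → ℕ
      distinct : Injective _≡_ _≡_ vertex
      arc      : ∀ (i : Fin k) → E (vertex (inject₁ i)) (vertex (suc i))
      closing  : E (vertex (fromℕ k)) (vertex zero)

  -- Deletion of vertices removes all arcs incident with them.
  delete : List ℕ → Rel ℕ 0ℓ → Rel ℕ 0ℓ
  delete F E v w = v ∉ F × w ∉ F × E v w

  IsCycleTransversal : Rel ℕ 0ℓ → List ℕ → Set
  IsCycleTransversal E F = ¬ Cycle (delete F E)

  StronglyConnected : Rel ℕ 0ℓ → Set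
  StronglyConnected E = ∀ v w → v ≢ w → Star E v w

module RealMatrix (R : Reals) where
  open Reals R
  open RawSemiringDefinitions (Semiring.rawSemiring semiring) public
    using (sum; _^_) renaming (_×_ to _·_)
  open Digraph

  ∣_∣<_ : Carrier → Carrier → Set
  ∣ x ∣< ε = - ε < x × x < ε

  infix 4 _⟶_
  _⟶_ : (ℕ → Carrier) → Carrier → Set
  f ⟶ l = ∀ ε → 0# < ε → ∃[ N ] ∀ n → N ℕ.≤ n → ∣ f n - l ∣< ε

  HasSum : (ℕ → Carrier) → Carrier → Set
  HasSum f s = (λ n → sum {n} (λ i → f (toℕ i))) ⟶ s

  -- f(n) = o(1/n), written as n f(n) → 0.
  IsLittleO[1/n] : (ℕ → Carrier) → Set
  IsLittleO[1/n] f = (λ n → n · f n) ⟶ 0#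

  infix  4 _≈ℂ_
  infix  5 _+i_
  infixl 6 _+ℂ_
  infixl 7 _*ℂ_
  record ℂ : Set where
    constructor _+i_
    field
      re im : Carrier
  open ℂ

  _≈ℂ_ : Rel ℂ 0ℓ
  z ≈ℂ w = re z ≈ re w × im z ≈ im w

  0ℂ : ℂ
  0ℂ = 0# +i 0#

  ofReal : Carrier → ℂ
  ofReal x = x +i 0#

  _+ℂ_ _*ℂ_ : ℂ → ℂ → ℂ
  z +ℂ w = (re z + re w) +i (im z + im w)
  z *ℂ w = (re z * re w - im z * im w) +i (re z * im w + im z * re w)

  sumℂ : ∀ {n} → Vector ℂ n → ℂ
  sumℂ = foldr _+ℂ_ 0ℂ

  -- r = ∣ z ∣
  IsModulus : ℂ → Carrier → Set
  IsModulus z r = 0# ≤ r × r * r ≈ re z * re z + im z * im z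

  FinMatrix : ℕ → Set
  FinMatrix n = Fin n → Fin n → Carrier

  IsEigenvalue : ∀ {n} → FinMatrix n → ℂ → Set
  IsEigenvalue {n} A μ = Σ[ x ∈ Vector ℂ n ]
    (∃[ i ] ¬ (x i ≈ℂ 0ℂ)) ×
    (∀ i → sumℂ (λ j → ofReal (A i j) *ℂ x j) ≈ℂ μ *ℂ x i)

  IsSpectralRadius : ∀ {n} → FinMatrix n → Carrier → Set
  IsSpectralRadius A = IsMaximum (λ r → ∃[ μ ] IsEigenvalue A μ × IsModulus μ r)

  Matrix : Set
  Matrix = ℕ → ℕ → Carrier

  NonNegative : Matrix → Set
  NonNegative M = ∀ v w → 0# ≤ M v w

  Arc : Matrix → Rel ℕ 0ℓ
  Arc M v w = ¬ (M v w ≈ 0#)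

  Irreducible : Matrix → Set
  Irreducible M = StronglyConnected (Arc M)

  HasFiniteCycleTransversal : Matrix → Set
  HasFiniteCycleTransversal M = ∃[ F ] IsCycleTransversal (Arc M) F

  StrictlyIncreasing : ∀ {n} → (Fin n → ℕ) → Set
  StrictlyIncreasing s = ∀ {i j} → i Fin.< j → s i ℕ.< s j

  submatrix : ∀ {n} → Matrix → (Fin n → ℕ) → FinMatrix n
  submatrix M s i j = M (s i) (s j)

  -- l = λₙ(M).  Only meaningful for n ≥ 1, as the empty matrix has no
  -- spectral radius.
  Isλₙ : Matrix → ℕ → Carrier → Set
  Isλₙ M n = IsSupremum (λ ρ →
    ∃[ s ] StrictlyIncreasing {n} s × IsSpectralRadius (submatrix M s) ρ)

  -- The sequence λₙ(M), n ≥ 1, and its limit λ(M).  That the limit l is an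
  -- element of the field expresses λ(M) < ∞.  The value ls 0 is irrelevant.
  record Isλ (M : Matrix) (ls : ℕ → Carrier) (l : Carrier) : Set where
    field
      isλₙ  : ∀ n → .{{NonZero n}} → Isλₙ M n (ls n)
      limit : ls ⟶ l

  identity : Matrix
  identity v w with v ≟ w
  ... | yes _ = 1#
  ... | no  _ = 0#

  -- P p = M ^ p.  The entries of M ^ (p + 1) are infinite series, hence a
  -- relation: it has no solution P if one of these series diverges.
  record IsPowers (M : Matrix) (P : ℕ → Matrix) : Set where
    field
      base : ∀ v w → P 0 v w ≈ identity v w
      step : ∀ p v w → HasSum (λ u → P p v u * M u w) (P (suc p) v w)

  -- The series Σₚ Mᵖ z⁻ᵖ converges entrywise; y plays the role of z⁻¹, so
  -- z ≠ 0.  For an irreducible infinite non-negative M, λ(M) > 0.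
  SeriesConvergesAt : Matrix → Carrier → Set
  SeriesConvergesAt M z = ∃[ y ] z * y ≈ 1# × ∃[ P ] IsPowers M P ×
    (∀ v w → ∃[ s ] HasSum (λ p → P p v w * y ^ p) s)

  -- In the following two definitions l = λ(M).
  Transient : Matrix → Carrier → Set
  Transient M l = SeriesConvergesAt M l

  Recurrent : Matrix → Carrier → Set
  Recurrent M l = ¬ Transient M l

-- Let l = λ(M), let F be a finite cycle transversal, and suppose the series
-- G = Σ Mᵖ l⁻ᵖ converges.  The positive row vector u = Σ_{f ∈ F} G f satisfies
-- u M ≤ l u, and on F even u M ≤ l u − l ≤ l (1 − δ) u for some δ > 0.  For a set S
-- of n indices put θ = 1 − δ/(n + 2), so that θ^(n+2) ≥ 1 − δ, and weight u by θ^e,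
-- where e = n + 1 on F and e(x) counts the elements of S that can be reached from
-- x avoiding F.  As S ∖ F is acyclic, e strictly decreases along its arcs, and the
-- weighted vector w satisfies w M_S ≤ θ l w.  Every eigenvalue of M_S therefore
-- has modulus at most θ l, so n (l − λₙ) ≥ l δ n/(n + 2), which is not o(1).

module Submission where

open import Defs
open import Axiom.ExcludedMiddle using (ExcludedMiddle)
open import Algebra.Bundles using (CommutativeRing)
import Algebra.Properties.Ring as RingProperties
import Algebra.Properties.Semiring.Sum as SumProperties
import Algebra.Solver.Ring.NaturalCoefficients.Default as SemiringSolver
open import Data.Bool using (true)
open import Data.Fin using (Fin; zero; suc; toℕ; fromℕ)
open import Data.Fin.Properties
  using (toℕ-injective; toℕ-fromℕ; toℕ-inject₁; toℕ≤pred[n]; toℕ<n)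
open import Data.Fin.Subset using (Subset; ∣_∣) renaming (_∈_ to _∈ˢ_)
open import Data.Fin.Subset.Properties using (∣p∣≤n; p⊂q⇒∣p∣<∣q∣)
open import Data.List using (List; _∷_; length; lookup)
open import Data.List.Membership.Propositional using (_∈_)
open import Data.List.Relation.Unary.Any using (there; index)
open import Data.List.Relation.Unary.Any.Properties using (lookup-index)
open import Data.Nat using (ℕ; zero; suc; pred; _⊔_; _∸_; z≤n; s≤s; >-nonZero)
  renaming (_+_ to _+ⁿ_; _≤_ to _≤ⁿ_; _<_ to _<ⁿ_)
open import Data.Nat.Induction using (Acc; acc; <-wellFounded)
import Data.Nat.Properties as ℕₚ
open import Data.Product using (∃; ∃-syntax; _×_; _,_; proj₁; proj₂)
open import Data.Sum using (inj₁; inj₂)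
open import Data.Vec using (tabulate)
open import Data.Vec.Functional using (Vector)
open import Data.Vec.Properties using (lookup∘tabulate; lookup⇒[]=; []=⇒lookup)
open import Function using (_∘_)
open import Level using (0ℓ)
open import Relation.Binary using (Rel; IsTotalOrder; Poset; tri<; tri≈; tri>)
open import Relation.Binary.Construct.Closure.ReflexiveTransitive
  using (Star; _◅_) renaming (ε to [])
open import Relation.Binary.Construct.Closure.Transitive using (TransClosure; [_]; _∷_)
import Relation.Binary.Construct.NonStrictToStrict as NonStrictToStrict
import Relation.Binary.PropositionalEquality as ≡
open ≡ using (_≡_)
import Relation.Binary.Reasoning.PartialOrder as PosetReasoning
open import Relation.Nullary using (¬_; Dec; yes; no; contradiction; does)
open import Relation.Nullary.Decidable using (dec-true)

-- No Perron-Frobenius theory enters: a positive row vector `w` with `w A ≤ κ w`, paired with the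
-- moduli of the entries of an eigenvector, already bounds every eigenvalue by `κ`. A single row
-- `G f` has its defect at `f` alone, where the term `p = 0` of the series contributes `l`; this is
-- why the rows are summed over all of `F`. The scale `δ` is chosen with `u x * δ ≤ 1#` on `F`,
-- which turns the constant defect `l` into a relative one. The obstacle is an arc ending in `F`:
-- the exponent may rise there from 0 to `n + 1`, and the conclusion asks for one factor `θ` more,
-- so `θ^(n+2)` has to be paid for by the defect. Bernoulli's inequality then dictates
-- `θ = 1 − δ/(n + 2)`. The exponents are at most `n + 1` on `n` indices, and this linear bound is
-- what makes the resulting gap of order `1/n`. Only inequalities over finite index sets are used,
-- so the identity `G M = l (G − I)` is replaced by a bound on finite subsums, and limits are needed
-- in one direction only.

-- Ordered-field arithmetic and finite sums.

module OrderedField (em : ExcludedMiddle 0ℓ) (R : Reals) where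
  open Reals R public
  open CommutativeRing commutativeRing public
    renaming (reflexive to ≈-reflexive)
    using ( refl; sym; trans; +-cong; +-congˡ; +-congʳ; *-cong; *-congˡ; *-congʳ
          ; -‿cong; +-comm; *-comm; +-identityˡ; +-identityʳ; *-identityˡ; *-identityʳ
          ; zeroˡ; zeroʳ; -‿inverseʳ; -‿inverseˡ; distribˡ; distribʳ; *-assoc; +-assoc
          ; commutativeSemiring; ring )
  open SumProperties semiring public
    using (sum-cong-≋; *-distribˡ-sum; *-distribʳ-sum; ∑-comm; ∑-distrib-+)
  open RealMatrix R public using (sum; _·_; _^_)
  open IsTotalOrder isTotalOrder public using (total; antisym; reflexive)
    renaming (refl to ≤-refl; trans to ≤-trans)
  open SemiringSolver commutativeSemiring public using (solve; _:=_; _:+_; _:*_; con)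
  open RingProperties ring public using (-‿involutive; -‿distribˡ-*; -‿distribʳ-*; -0#≈0#)

  poset : Poset 0ℓ 0ℓ 0ℓ
  poset = record { isPartialOrder = IsTotalOrder.isPartialOrder isTotalOrder }

  open PosetReasoning poset public hiding (_IsRelatedTo_)

  ≰⇒> : ∀ {x y} → ¬ (x ≤ y) → y < x
  ≰⇒> = NonStrictToStrict.≰⇒> _≈_ _≤_ sym reflexive total

  <⇒≱ : ∀ {x y} → x < y → ¬ (y ≤ x)
  <⇒≱ = NonStrictToStrict.<⇒≱ _≈_ _≤_ antisym

  ≤∧≱⇒< : ∀ {x y} → x ≤ y → ¬ (y ≤ x) → x < y
  ≤∧≱⇒< x≤y y≰x = x≤y , y≰x ∘ reflexive ∘ sym

  <-≤-trans : ∀ {x y z} → x < y → y ≤ z → x < z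
  <-≤-trans x<y y≤z = ≤∧≱⇒< (≤-trans (proj₁ x<y) y≤z) (λ z≤x → <⇒≱ x<y (≤-trans y≤z z≤x))

  +-monoʳ-≤ : ∀ z {x y} → x ≤ y → z + x ≤ z + y
  +-monoʳ-≤ z {x} {y} x≤y = begin
    z + x ≈⟨ +-comm z x ⟩
    x + z ≤⟨ +-monoˡ-≤ z x≤y ⟩
    y + z ≈⟨ +-comm y z ⟩
    z + y ∎

  +-mono-≤ : ∀ {x y u v} → x ≤ y → u ≤ v → x + u ≤ y + v
  +-mono-≤ x≤y u≤v = ≤-trans (+-monoˡ-≤ _ x≤y) (+-monoʳ-≤ _ u≤v)

  +-cancelʳ-≤ : ∀ z {x y} → x + z ≤ y + z → x ≤ y
  +-cancelʳ-≤ z {x} {y} p = begin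
    x               ≈⟨ undo x ⟨
    x + z + (- z)   ≤⟨ +-monoˡ-≤ (- z) p ⟩
    y + z + (- z)   ≈⟨ undo y ⟩
    y               ∎
    where
    undo : ∀ a → a + z + (- z) ≈ a
    undo a = trans (+-assoc a z (- z)) (trans (+-congˡ (-‿inverseʳ z)) (+-identityʳ a))

  x-y+y≈x : ∀ x y → (x - y) + y ≈ x
  x-y+y≈x x y = trans (+-assoc x (- y) y) (trans (+-congˡ (-‿inverseˡ y)) (+-identityʳ x))

  -- Inequalities are traded for an additive witness because the semiring solver, which does the
  -- algebra below, knows no subtraction.
  ≤⇒∃+ : ∀ {x y} → x ≤ y → ∃[ d ] 0# ≤ d × y ≈ x + d
  ≤⇒∃+ {x} {y} x≤y = y - x
    , +-cancelʳ-≤ x (begin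
        0# + x     ≈⟨ +-identityˡ x ⟩
        x          ≤⟨ x≤y ⟩
        y          ≈⟨ x-y+y≈x y x ⟨
        y - x + x  ∎)
    , trans (sym (x-y+y≈x y x)) (+-comm (y - x) x)

  x≤x+y : ∀ {x y} → 0# ≤ y → x ≤ x + y
  x≤x+y {x} {y} 0≤y = begin
    x       ≈⟨ +-identityʳ x ⟨
    x + 0#  ≤⟨ +-monoʳ-≤ x 0≤y ⟩
    x + y   ∎

  x≤y+x : ∀ {x y} → 0# ≤ y → x ≤ y + x
  x≤y+x {x} {y} 0≤y = ≤-trans (x≤x+y 0≤y) (reflexive (+-comm x y))

  +-nonNeg : ∀ {x y} → 0# ≤ x → 0# ≤ y → 0# ≤ x + y
  +-nonNeg 0≤x 0≤y = ≤-trans 0≤x (x≤x+y 0≤y)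

  *-monoˡ-≤ : ∀ {x y z} → 0# ≤ z → x ≤ y → x * z ≤ y * z
  *-monoˡ-≤ {x} {y} {z} 0≤z x≤y with ≤⇒∃+ x≤y
  ... | d , 0≤d , y≈x+d = begin
    x * z          ≤⟨ x≤x+y (*-nonNeg 0≤d 0≤z) ⟩
    x * z + d * z  ≈⟨ distribʳ z x d ⟨
    (x + d) * z    ≈⟨ *-congʳ y≈x+d ⟨
    y * z          ∎

  *-monoʳ-≤ : ∀ {x y z} → 0# ≤ z → x ≤ y → z * x ≤ z * y
  *-monoʳ-≤ {x} {y} {z} 0≤z x≤y = begin
    z * x ≈⟨ *-comm z x ⟩
    x * z ≤⟨ *-monoˡ-≤ 0≤z x≤y ⟩
    y * z ≈⟨ *-comm y z ⟩
    z * y ∎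

  *-mono-≤ : ∀ {x y u v} → 0# ≤ y → 0# ≤ u → x ≤ y → u ≤ v → x * u ≤ y * v
  *-mono-≤ 0≤y 0≤u x≤y u≤v = ≤-trans (*-monoˡ-≤ 0≤u x≤y) (*-monoʳ-≤ 0≤y u≤v)

  0≤x*x : ∀ x → 0# ≤ x * x
  0≤x*x x with total 0# x
  ... | inj₁ 0≤x = *-nonNeg 0≤x 0≤x
  ... | inj₂ x≤0 with ≤⇒∃+ x≤0
  ...   | d , 0≤d , 0≈x+d = begin
    0#                  ≤⟨ *-nonNeg 0≤d 0≤d ⟩
    d * d               ≈⟨ trans (+-congʳ (zeroʳ x)) (+-identityˡ _) ⟨
    x * 0# + d * d      ≈⟨ +-congʳ (*-congˡ 0≈x+d) ⟩
    x * (x + d) + d * d ≈⟨ solve 2 (λ x d → x :* (x :+ d) :+ d :* d := x :* x :+ (x :+ d) :* d) refl x d ⟩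
    x * x + (x + d) * d ≈⟨ +-congˡ (*-congʳ 0≈x+d) ⟨
    x * x + 0# * d      ≈⟨ trans (+-congˡ (zeroˡ d)) (+-identityʳ _) ⟩
    x * x               ∎

  0≤1 : 0# ≤ 1#
  0≤1 = ≤-trans (0≤x*x 1#) (reflexive (*-identityˡ 1#))

  0<1 : 0# < 1#
  0<1 = 0≤1 , 0≉1

  inverse⁺ : ∀ {x} → 0# < x → ∃[ y ] 0# < y × x * y ≈ 1#
  inverse⁺ {x} (0≤x , 0≉x) with inverse x (0≉x ∘ sym)
  ... | y , xy≈1 = y , (0≤y , 0≉y) , xy≈1
    where
    0≤y : 0# ≤ y
    0≤y = begin
      0#            ≤⟨ *-nonNeg 0≤x (0≤x*x y) ⟩
      x * (y * y)   ≈⟨ *-assoc x y y ⟨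
      x * y * y     ≈⟨ *-congʳ xy≈1 ⟩
      1# * y        ≈⟨ *-identityˡ y ⟩
      y             ∎
    0≉y : ¬ (0# ≈ y)
    0≉y 0≈y = 0≉1 (trans (sym (zeroʳ x)) (trans (*-congˡ 0≈y) xy≈1))

  *-cancelʳ-≤ : ∀ {x y z} → 0# < z → x * z ≤ y * z → x ≤ y
  *-cancelʳ-≤ {x} {y} {z} 0<z p with inverse⁺ 0<z
  ... | w , 0<w , zw≈1 = begin
    x           ≈⟨ undo x ⟨
    x * z * w   ≤⟨ *-monoˡ-≤ (proj₁ 0<w) p ⟩
    y * z * w   ≈⟨ undo y ⟩
    y           ∎
    where
    undo : ∀ a → a * z * w ≈ a
    undo a = trans (*-assoc a z w) (trans (*-congˡ zw≈1) (*-identityʳ a))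

  *-pos : ∀ {x y} → 0# < x → 0# < y → 0# < x * y
  *-pos {x} {y} 0<x 0<y = ≤∧≱⇒< (*-nonNeg (proj₁ 0<x) (proj₁ 0<y)) λ xy≤0 →
    <⇒≱ 0<x (*-cancelʳ-≤ 0<y (≤-trans xy≤0 (reflexive (sym (zeroˡ y)))))

  -- If `x ≰ y`, then `x` is positive and cancels from `x * x ≤ y * y ≤ y * x`. Bounds on squared
  -- moduli become bounds on moduli this way.
  x*x≤y*y⇒x≤y : ∀ {x y} → 0# ≤ y → x * x ≤ y * y → x ≤ y
  x*x≤y*y⇒x≤y {x} {y} 0≤y p with em {x ≤ y}
  ... | yes x≤y = x≤y
  ... | no x≰y = contradiction (*-cancelʳ-≤ 0<x (≤-trans p (*-monoʳ-≤ 0≤y y≤x))) x≰y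
    where
    y≤x = proj₁ (≰⇒> x≰y)
    0<x = ≤∧≱⇒< (≤-trans 0≤y y≤x) (λ x≤0 → x≰y (≤-trans x≤0 0≤y))

  ≤∧≉⇒∃+ : ∀ {x y} → x ≤ y → ¬ (x ≈ y) → ∃[ d ] 0# < d × y ≈ x + d
  ≤∧≉⇒∃+ {x} x≤y x≉y with ≤⇒∃+ x≤y
  ... | d , 0≤d , y≈x+d = d
    , (0≤d , λ 0≈d → x≉y (sym (trans y≈x+d (trans (+-congˡ (sym 0≈d)) (+-identityʳ x)))))
    , y≈x+d

  x+y≰x : ∀ {x y} → 0# < y → ¬ (x + y ≤ x)
  x+y≰x {x} {y} 0<y p = <⇒≱ 0<y (+-cancelʳ-≤ x (begin
    y + x   ≈⟨ +-comm y x ⟩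
    x + y   ≤⟨ p ⟩
    x       ≈⟨ +-identityˡ x ⟨
    0# + x  ∎))

  -- Square roots from completeness.

  private
    -- The increment is `ε = d / q` with `q = s + s + d + 1#`. Since `q ≥ 1#`, it satisfies `ε ≤ d`,
    -- so `ε * (s + s + ε)` stays below `ε * q ≈ d`.
    step-up : ∀ {s d} → 0# ≤ s → 0# < d → ∃[ ε ] 0# < ε × (s + ε) * (s + ε) ≤ s * s + d
    step-up {s} {d} 0≤s 0<d with inverse⁺ 0<q
      where
      q = s + s + d + 1#
      0<q : 0# < q
      0<q = <-≤-trans 0<1 (x≤y+x (+-nonNeg (+-nonNeg 0≤s 0≤s) (proj₁ 0<d)))
    ... | w , 0<w , qw≈1 = ε , *-pos 0<d 0<w , (begin
      (s + ε) * (s + ε)        ≈⟨ solve 2 (λ s e → (s :+ e) :* (s :+ e) := s :* s :+ e :* (s :+ s :+ e)) refl s ε ⟩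
      s * s + ε * (s + s + ε)  ≤⟨ +-monoʳ-≤ (s * s) (*-monoʳ-≤ 0≤ε (+-monoʳ-≤ (s + s) ε≤d+1)) ⟩
      s * s + ε * (s + s + (d + 1#)) ≈⟨ +-congˡ ε*q≈d ⟩
      s * s + d                ∎)
      where
      ε = d * w
      0≤ε = *-nonNeg (proj₁ 0<d) (proj₁ 0<w)
      ε*q≈d : ε * (s + s + (d + 1#)) ≈ d
      ε*q≈d = begin-equality
        d * w * (s + s + (d + 1#))    ≈⟨ *-assoc d w _ ⟩
        d * (w * (s + s + (d + 1#)))  ≈⟨ *-congˡ (trans (*-comm w _) (*-congʳ (sym (+-assoc (s + s) d 1#)))) ⟩
        d * ((s + s + d + 1#) * w)    ≈⟨ *-congˡ qw≈1 ⟩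
        d * 1#                        ≈⟨ *-identityʳ d ⟩
        d                             ∎
      ε≤d+1 : ε ≤ d + 1#
      ε≤d+1 = begin
        ε                         ≈⟨ *-identityʳ ε ⟨
        ε * 1#                    ≤⟨ *-monoʳ-≤ 0≤ε (≤-trans (x≤y+x (proj₁ 0<d)) (x≤y+x (+-nonNeg 0≤s 0≤s))) ⟩
        ε * (s + s + (d + 1#))    ≈⟨ ε*q≈d ⟩
        d                         ≤⟨ x≤x+y 0≤1 ⟩
        d + 1#                    ∎

    -- One Newton step from `s` towards the root of `a`: with `ε = d / (s + s)` and `r = s - ε`, the
    -- square `r * r` equals `a + ε * ε`. Such an `r` is an upper bound below the supremum `s`.
    step-down : ∀ {s a d} → 0# ≤ s → 0# ≤ a → 0# < d → s * s ≈ a + d →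
                ∃[ r ] 0# ≤ r × ¬ (s ≤ r) × a ≤ r * r
    step-down {s} {a} {d} 0≤s 0≤a 0<d s*s≈a+d with inverse⁺ 0<2s
      where
      0<2s : 0# < s + s
      0<2s = ≤∧≱⇒< (+-nonNeg 0≤s 0≤s) λ 2s≤0 → <⇒≱ 0<d (begin
        d             ≤⟨ x≤y+x 0≤a ⟩
        a + d         ≈⟨ s*s≈a+d ⟨
        s * s         ≤⟨ *-monoʳ-≤ 0≤s (≤-trans (x≤x+y 0≤s) 2s≤0) ⟩
        s * 0#        ≈⟨ zeroʳ s ⟩
        0#            ∎)
    ... | w , 0<w , 2s*w≈1 with ≤⇒∃+ ε≤s
      where
      ε≤s : d * w ≤ s
      ε≤s = begin
        d * w              ≤⟨ *-monoˡ-≤ (proj₁ 0<w) (x≤y+x 0≤a) ⟩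
        (a + d) * w        ≈⟨ *-congʳ s*s≈a+d ⟨
        s * s * w          ≤⟨ *-monoˡ-≤ (proj₁ 0<w) (*-monoʳ-≤ 0≤s (x≤x+y 0≤s)) ⟩
        s * (s + s) * w    ≈⟨ trans (*-assoc s _ w) (*-congˡ 2s*w≈1) ⟩
        s * 1#             ≈⟨ *-identityʳ s ⟩
        s                  ∎
    ...   | r , 0≤r , s≈ε+r = r , 0≤r
      , (λ s≤r → x+y≰x (*-pos 0<d 0<w) (≤-trans (reflexive (trans (+-comm r ε) (sym s≈ε+r))) s≤r))
      , +-cancelʳ-≤ d (begin
          a + d                                  ≈⟨ s*s≈a+d ⟨
          s * s                                  ≈⟨ *-cong s≈ε+r s≈ε+r ⟩
          (ε + r) * (ε + r)                      ≤⟨ x≤x+y (0≤x*x ε) ⟩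
          (ε + r) * (ε + r) + ε * ε              ≈⟨ solve 2 (λ e r → (e :+ r) :* (e :+ r) :+ e :* e := r :* r :+ e :* ((e :+ r) :+ (e :+ r))) refl ε r ⟩
          r * r + ε * ((ε + r) + (ε + r))        ≈⟨ +-congˡ (*-congˡ (+-cong s≈ε+r s≈ε+r)) ⟨
          r * r + ε * (s + s)                    ≈⟨ +-congˡ ε*2s≈d ⟩
          r * r + d                              ∎)
      where
      ε = d * w
      ε*2s≈d : ε * (s + s) ≈ d
      ε*2s≈d = begin-equality
        d * w * (s + s)    ≈⟨ *-assoc d w _ ⟩
        d * (w * (s + s))  ≈⟨ *-congˡ (*-comm w _) ⟩
        d * ((s + s) * w)  ≈⟨ *-congˡ 2s*w≈1 ⟩
        d * 1#             ≈⟨ *-identityʳ d ⟩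
        d                  ∎

    sup-squared : ∀ {a s} → 0# ≤ s → 0# ≤ a → IsSupremum (λ t → t * t ≤ a) s → s * s ≈ a
    sup-squared {a} {s} 0≤s 0≤a (upper , least) with em {s * s ≈ a}
    ... | yes p = p
    ... | no s*s≉a with total (s * s) a
    ...   | inj₁ s*s≤a =
      let d , 0<d , a≈s*s+d = ≤∧≉⇒∃+ s*s≤a s*s≉a
          ε , 0<ε , step = step-up 0≤s 0<d
      in contradiction (upper (s + ε) (≤-trans step (reflexive (sym a≈s*s+d)))) (x+y≰x 0<ε)
    ...   | inj₂ a≤s*s =
      let d , 0<d , s*s≈a+d = ≤∧≉⇒∃+ a≤s*s (s*s≉a ∘ sym)
          r , 0≤r , s≰r , a≤r*r = step-down 0≤s 0≤a 0<d s*s≈a+d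
      in contradiction (least r λ t t*t≤a → x*x≤y*y⇒x≤y 0≤r (≤-trans t*t≤a a≤r*r)) s≰r

    square-bounded : ∀ {a} → 0# ≤ a → UpperBound (λ t → t * t ≤ a) (a + 1#)
    square-bounded {a} 0≤a t t*t≤a = x*x≤y*y⇒x≤y (+-nonNeg 0≤a 0≤1) (begin
      t * t                        ≤⟨ t*t≤a ⟩
      a                            ≤⟨ x≤x+y (+-nonNeg (+-nonNeg 0≤a 0≤1) (0≤x*x a)) ⟩
      a + (a + 1# + a * a)         ≈⟨ solve 1 (λ a → a :+ (a :+ con 1 :+ a :* a) := (a :+ con 1) :* (a :+ con 1)) refl a ⟩
      (a + 1#) * (a + 1#)          ∎)

    sup-sqrt : ∀ {a} → 0# ≤ a → ∃ (IsSupremum (λ t → t * t ≤ a)) → ∃[ s ] 0# ≤ s × s * s ≈ a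
    sup-sqrt 0≤a (s , isSup) = s , 0≤s , sup-squared 0≤s 0≤a isSup
      where
      0≤s : 0# ≤ s
      0≤s = proj₁ isSup 0# (≤-trans (reflexive (zeroˡ 0#)) 0≤a)

  -- Needed for the moduli of the entries of an eigenvector, which are given only through their
  -- squares.
  sqrt : ∀ a → 0# ≤ a → ∃[ s ] 0# ≤ s × s * s ≈ a
  sqrt a 0≤a = sup-sqrt 0≤a (complete (λ t → t * t ≤ a)
    (0# , ≤-trans (reflexive (zeroˡ 0#)) 0≤a) (a + 1# , square-bounded 0≤a))

  sum-mono : ∀ {n} {f g : Vector Carrier n} → (∀ i → f i ≤ g i) → sum f ≤ sum g
  sum-mono {zero}  f≤g = ≤-refl
  sum-mono {suc n} f≤g = +-mono-≤ (f≤g zero) (sum-mono (f≤g ∘ suc))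

  sum-nonNeg : ∀ {n} {f : Vector Carrier n} → (∀ i → 0# ≤ f i) → 0# ≤ sum f
  sum-nonNeg {zero}  0≤f = ≤-refl
  sum-nonNeg {suc n} 0≤f = +-nonNeg (0≤f zero) (sum-nonNeg (0≤f ∘ suc))

  term≤sum : ∀ {n} {f : Vector Carrier n} → (∀ i → 0# ≤ f i) → ∀ i → f i ≤ sum f
  term≤sum 0≤f zero    = x≤x+y (sum-nonNeg (0≤f ∘ suc))
  term≤sum 0≤f (suc i) = ≤-trans (term≤sum (0≤f ∘ suc) i) (x≤y+x (0≤f zero))

-- Bounding eigenvalues by a positive subinvariant row vector.

module SpectralBound (em : ExcludedMiddle 0ℓ) (R : Reals) where
  open OrderedField em R
  open RealMatrix R hiding (sum; _·_; _^_)
  open ℂ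

  normSq : ℂ → Carrier
  normSq z = re z * re z + im z * im z

  normSq-nonNeg : ∀ z → 0# ≤ normSq z
  normSq-nonNeg z = +-nonNeg (0≤x*x (re z)) (0≤x*x (im z))

  normSq-cong : ∀ {z w} → z ≈ℂ w → normSq z ≈ normSq w
  normSq-cong (p , q) = +-cong (*-cong p p) (*-cong q q)

  -- This is `0 ≤ (x - y)²`; writing the larger number as the smaller plus `d` keeps it free of
  -- subtraction.
  x*y+y*x≤x*x+y*y : ∀ x y → x * y + y * x ≤ x * x + y * y
  x*y+y*x≤x*x+y*y x y with total x y
  ... | inj₁ x≤y = let d , 0≤d , y≈x+d = ≤⇒∃+ x≤y in begin
    x * y + y * x                          ≈⟨ +-cong (*-congˡ y≈x+d) (*-congʳ y≈x+d) ⟩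
    x * (x + d) + (x + d) * x              ≤⟨ x≤x+y (0≤x*x d) ⟩
    x * (x + d) + (x + d) * x + d * d      ≈⟨ solve 2 (λ x d → x :* (x :+ d) :+ (x :+ d) :* x :+ d :* d := x :* x :+ (x :+ d) :* (x :+ d)) refl x d ⟩
    x * x + (x + d) * (x + d)              ≈⟨ +-congˡ (*-cong y≈x+d y≈x+d) ⟨
    x * x + y * y                          ∎
  ... | inj₂ y≤x = let d , 0≤d , x≈y+d = ≤⇒∃+ y≤x in begin
    x * y + y * x                          ≈⟨ +-cong (*-congʳ x≈y+d) (*-congˡ x≈y+d) ⟩
    (y + d) * y + y * (y + d)              ≤⟨ x≤x+y (0≤x*x d) ⟩
    (y + d) * y + y * (y + d) + d * d      ≈⟨ solve 2 (λ y d → (y :+ d) :* y :+ y :* (y :+ d) :+ d :* d := (y :+ d) :* (y :+ d) :+ y :* y) refl y d ⟩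
    (y + d) * (y + d) + y * y              ≈⟨ +-congʳ (*-cong x≈y+d x≈y+d) ⟨
    x * x + y * y                          ∎

  -- After expansion the two sides differ only in the mixed terms, which compare by the previous
  -- inequality at `a * d` and `b * c`.
  cauchy-schwarz : ∀ a b c d →
    (a * c + b * d) * (a * c + b * d) ≤ (a * a + b * b) * (c * c + d * d)
  cauchy-schwarz a b c d = begin
    (a * c + b * d) * (a * c + b * d)
      ≈⟨ solve 4 (λ a b c d → (a :* c :+ b :* d) :* (a :* c :+ b :* d) :=
           (a :* c :* (a :* c) :+ b :* d :* (b :* d)) :+ (a :* d :* (b :* c) :+ b :* c :* (a :* d))) refl a b c d ⟩
    (a * c * (a * c) + b * d * (b * d)) + (a * d * (b * c) + b * c * (a * d))
      ≤⟨ +-monoʳ-≤ _ (x*y+y*x≤x*x+y*y (a * d) (b * c)) ⟩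
    (a * c * (a * c) + b * d * (b * d)) + (a * d * (a * d) + b * c * (b * c))
      ≈⟨ solve 4 (λ a b c d →
           (a :* c :* (a :* c) :+ b :* d :* (b :* d)) :+ (a :* d :* (a :* d) :+ b :* c :* (b :* c)) :=
           (a :* a :+ b :* b) :* (c :* c :+ d :* d)) refl a b c d ⟩
    (a * a + b * b) * (c * c + d * d) ∎

  -- The triangle inequality with `p` and `q` in place of the moduli, so that no root is taken. The
  -- cross term is the real inner product, at most `p * q` by Cauchy-Schwarz.
  normSq-triangle : ∀ {z w p q} → 0# ≤ p → 0# ≤ q → normSq z ≤ p * p → normSq w ≤ q * q →
                    normSq (z +ℂ w) ≤ (p + q) * (p + q)
  normSq-triangle {a +i b} {c +i d} {p} {q} 0≤p 0≤q z≤p w≤q = begin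
    (a + c) * (a + c) + (b + d) * (b + d)
      ≈⟨ solve 4 (λ a b c d → (a :+ c) :* (a :+ c) :+ (b :+ d) :* (b :+ d) :=
           ((a :* a :+ b :* b) :+ (c :* c :+ d :* d)) :+ ((a :* c :+ b :* d) :+ (a :* c :+ b :* d))) refl a b c d ⟩
    ((a * a + b * b) + (c * c + d * d)) + ((a * c + b * d) + (a * c + b * d))
      ≤⟨ +-mono-≤ (+-mono-≤ z≤p w≤q) (+-mono-≤ inner inner) ⟩
    (p * p + q * q) + (p * q + p * q)
      ≈⟨ solve 2 (λ p q → (p :* p :+ q :* q) :+ (p :* q :+ p :* q) := (p :+ q) :* (p :+ q)) refl p q ⟩
    (p + q) * (p + q) ∎
    where
    inner : a * c + b * d ≤ p * q
    inner = x*x≤y*y⇒x≤y (*-nonNeg 0≤p 0≤q) (begin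
      (a * c + b * d) * (a * c + b * d)  ≤⟨ cauchy-schwarz a b c d ⟩
      (a * a + b * b) * (c * c + d * d)  ≤⟨ *-mono-≤ (0≤x*x p) (normSq-nonNeg (c +i d)) z≤p w≤q ⟩
      p * p * (q * q)                    ≈⟨ solve 2 (λ p q → p :* p :* (q :* q) := p :* q :* (p :* q)) refl p q ⟩
      p * q * (p * q)                    ∎)

  normSq-* : ∀ z w → normSq (z *ℂ w) ≈ normSq z * normSq w
  normSq-* (a +i b) (c +i d) = begin-equality
    (a * c + - (b * d)) * (a * c + - (b * d)) + (a * d + b * c) * (a * d + b * c)
      ≈⟨ +-congʳ (*-cong minus minus) ⟩
    (a * c + b′ * d) * (a * c + b′ * d) + (a * d + b * c) * (a * d + b * c)
      -- The solver treats `- b` as a fresh variable `b′`; the relations `b′ + b ≈ 0#` and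
      -- `b′ * b′ ≈ b * b` are applied afterwards.
      ≈⟨ solve 5 (λ a b b′ c d →
           (a :* c :+ b′ :* d) :* (a :* c :+ b′ :* d) :+ (a :* d :+ b :* c) :* (a :* d :+ b :* c) :=
           (a :* a :* (c :* c) :+ b′ :* b′ :* (d :* d) :+ a :* a :* (d :* d) :+ b :* b :* (c :* c))
             :+ (b′ :+ b) :* ((a :* c :* d) :+ (a :* c :* d))) refl a b b′ c d ⟩
    (a * a * (c * c) + b′ * b′ * (d * d) + a * a * (d * d) + b * b * (c * c)) + (b′ + b) * ((a * c * d) + (a * c * d))
      ≈⟨ +-cong (+-congʳ (+-congʳ (+-congˡ (*-congʳ b′*b′≈b*b)))) (trans (*-congʳ (-‿inverseˡ b)) (zeroˡ _)) ⟩
    (a * a * (c * c) + b * b * (d * d) + a * a * (d * d) + b * b * (c * c)) + 0#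
      ≈⟨ +-identityʳ _ ⟩
    a * a * (c * c) + b * b * (d * d) + a * a * (d * d) + b * b * (c * c)
      ≈⟨ solve 4 (λ a b c d →
           a :* a :* (c :* c) :+ b :* b :* (d :* d) :+ a :* a :* (d :* d) :+ b :* b :* (c :* c) :=
           (a :* a :+ b :* b) :* (c :* c :+ d :* d)) refl a b c d ⟩
    (a * a + b * b) * (c * c + d * d) ∎
    where
    b′ = - b
    minus : a * c + - (b * d) ≈ a * c + b′ * d
    minus = +-congˡ (-‿distribˡ-* b d)
    b′*b′≈b*b : b′ * b′ ≈ b * b
    b′*b′≈b*b = trans (sym (-‿distribˡ-* b b′)) (trans (-‿cong (sym (-‿distribʳ-* b b))) (-‿involutive (b * b)))

  normSq-ofReal : ∀ a → normSq (ofReal a) ≈ a * a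
  normSq-ofReal a = trans (+-congˡ (zeroˡ 0#)) (+-identityʳ _)

  normSq-scale : ∀ {a p} z → normSq z ≤ p * p → normSq (ofReal a *ℂ z) ≤ a * p * (a * p)
  normSq-scale {a} {p} z z≤p = begin
    normSq (ofReal a *ℂ z)         ≈⟨ normSq-* (ofReal a) z ⟩
    normSq (ofReal a) * normSq z   ≈⟨ *-congʳ (normSq-ofReal a) ⟩
    a * a * normSq z               ≤⟨ *-monoʳ-≤ (0≤x*x a) z≤p ⟩
    a * a * (p * p)                ≈⟨ solve 2 (λ a p → a :* a :* (p :* p) := a :* p :* (a :* p)) refl a p ⟩
    a * p * (a * p)                ∎

  normSq-sum : ∀ {n} (a c : Vector Carrier n) (x : Vector ℂ n) →
    (∀ j → 0# ≤ a j) → (∀ j → 0# ≤ c j) → (∀ j → normSq (x j) ≤ c j * c j) →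
    normSq (sumℂ (λ j → ofReal (a j) *ℂ x j)) ≤ sum (λ j → a j * c j) * sum (λ j → a j * c j)
  normSq-sum {zero}  a c x 0≤a 0≤c x≤c = reflexive (trans (+-congˡ (zeroˡ 0#)) (+-identityʳ _))
  normSq-sum {suc n} a c x 0≤a 0≤c x≤c = normSq-triangle
    {z = ofReal (a zero) *ℂ x zero} {w = sumℂ (λ j → ofReal (a (suc j)) *ℂ x (suc j))}
    (*-nonNeg (0≤a zero) (0≤c zero))
    (sum-nonNeg (λ j → *-nonNeg (0≤a (suc j)) (0≤c (suc j))))
    (normSq-scale (x zero) (x≤c zero))
    (normSq-sum (a ∘ suc) (c ∘ suc) (x ∘ suc) (0≤a ∘ suc) (0≤c ∘ suc) (x≤c ∘ suc))

  normSq≤0⇒≈0 : ∀ z → normSq z ≤ 0# → z ≈ℂ 0ℂ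
  normSq≤0⇒≈0 (a +i b) p = zero-of (≤-trans (x≤x+y (0≤x*x b)) p) , zero-of (≤-trans (x≤y+x (0≤x*x a)) p)
    where
    zero-of : ∀ {x} → x * x ≤ 0# → x ≈ 0#
    zero-of {x} q with em {x ≈ 0#}
    ... | yes x≈0 = x≈0
    ... | no x≉0 = let y , xy≈1 = inverse x x≉0 in contradiction (begin
      1#               ≈⟨ trans (*-cong xy≈1 xy≈1) (*-identityˡ 1#) ⟨
      x * y * (x * y)  ≈⟨ solve 2 (λ x y → x :* y :* (x :* y) := x :* x :* (y :* y)) refl x y ⟩
      x * x * (y * y)  ≤⟨ *-monoˡ-≤ (0≤x*x y) q ⟩
      0# * (y * y)     ≈⟨ zeroˡ _ ⟩
      0#               ∎) (<⇒≱ 0<1)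

  -- With `c` the entrywise modulus of the eigenvector `x`, the triangle inequality gives
  -- `r c ≤ A c`. Pairing with `w` yields `r (w c) ≤ w A c ≤ κ (w c)`, and `w c` is positive because
  -- `x` is non-zero and `w` is positive.
  modulus≤ : ∀ {n} (A : FinMatrix n) (w : Vector Carrier n) {κ} →
    (∀ i j → 0# ≤ A i j) → (∀ i → 0# < w i) →
    (∀ j → sum (λ i → w i * A i j) ≤ κ * w j) →
    ∀ {μ r} → IsEigenvalue A μ → IsModulus μ r → r ≤ κ
  modulus≤ {n} A w {κ} 0≤A 0<w wA≤κw {μ} {r} (x , (k , xk≉0) , Ax≈μx) (0≤r , r*r≈) =
    *-cancelʳ-≤ 0<W (begin
      r * sum (λ i → w i * c i)                   ≈⟨ *-distribˡ-sum r (λ i → w i * c i) ⟩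
      sum (λ i → r * (w i * c i))                 ≤⟨ sum-mono rwc≤ ⟩
      sum (λ i → sum (λ j → w i * A i j * c j))   ≈⟨ ∑-comm (λ i j → w i * A i j * c j) ⟩
      sum (λ j → sum (λ i → w i * A i j * c j))   ≤⟨ sum-mono wAc≤ ⟩
      sum (λ j → κ * (w j * c j))                 ≈⟨ *-distribˡ-sum κ (λ j → w j * c j) ⟨
      κ * sum (λ j → w j * c j)                   ∎)
    where
    c : Vector Carrier n
    c j = proj₁ (sqrt (normSq (x j)) (normSq-nonNeg (x j)))

    0≤c : ∀ j → 0# ≤ c j
    0≤c j = proj₁ (proj₂ (sqrt (normSq (x j)) (normSq-nonNeg (x j))))

    c*c≈ : ∀ j → c j * c j ≈ normSq (x j)
    c*c≈ j = proj₂ (proj₂ (sqrt (normSq (x j)) (normSq-nonNeg (x j))))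

    rc≤ : ∀ i → r * c i ≤ sum (λ j → A i j * c j)
    rc≤ i = x*x≤y*y⇒x≤y (sum-nonNeg (λ j → *-nonNeg (0≤A i j) (0≤c j))) (begin
      r * c i * (r * c i)        ≈⟨ solve 2 (λ r c → r :* c :* (r :* c) := r :* r :* (c :* c)) refl r (c i) ⟩
      r * r * (c i * c i)        ≈⟨ *-cong r*r≈ (c*c≈ i) ⟩
      normSq μ * normSq (x i)    ≈⟨ normSq-* μ (x i) ⟨
      normSq (μ *ℂ x i)          ≈⟨ normSq-cong (Ax≈μx i) ⟨
      normSq (sumℂ (λ j → ofReal (A i j) *ℂ x j))
        ≤⟨ normSq-sum (A i) c x (0≤A i) 0≤c (λ j → reflexive (sym (c*c≈ j))) ⟩
      sum (λ j → A i j * c j) * sum (λ j → A i j * c j) ∎)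

    rwc≤ : ∀ i → r * (w i * c i) ≤ sum (λ j → w i * A i j * c j)
    rwc≤ i = begin
      r * (w i * c i)                  ≈⟨ solve 3 (λ r w c → r :* (w :* c) := w :* (r :* c)) refl r (w i) (c i) ⟩
      w i * (r * c i)                  ≤⟨ *-monoʳ-≤ (proj₁ (0<w i)) (rc≤ i) ⟩
      w i * sum (λ j → A i j * c j)    ≈⟨ *-distribˡ-sum (w i) (λ j → A i j * c j) ⟩
      sum (λ j → w i * (A i j * c j))  ≈⟨ sum-cong-≋ (λ j → *-assoc (w i) (A i j) (c j)) ⟨
      sum (λ j → w i * A i j * c j)    ∎

    wAc≤ : ∀ j → sum (λ i → w i * A i j * c j) ≤ κ * (w j * c j)
    wAc≤ j = begin
      sum (λ i → w i * A i j * c j)    ≈⟨ *-distribʳ-sum (c j) (λ i → w i * A i j) ⟨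
      sum (λ i → w i * A i j) * c j    ≤⟨ *-monoˡ-≤ (0≤c j) (wA≤κw j) ⟩
      κ * w j * c j                    ≈⟨ *-assoc κ (w j) (c j) ⟩
      κ * (w j * c j)                  ∎

    0<ck : 0# < c k
    0<ck = ≤∧≱⇒< (0≤c k) λ ck≤0 → xk≉0 (normSq≤0⇒≈0 (x k) (begin
      normSq (x k)   ≈⟨ c*c≈ k ⟨
      c k * c k      ≤⟨ *-monoʳ-≤ (0≤c k) ck≤0 ⟩
      c k * 0#       ≈⟨ zeroʳ (c k) ⟩
      0#             ∎))

    0<W : 0# < sum (λ i → w i * c i)
    0<W = <-≤-trans (*-pos (0<w k) 0<ck) (term≤sum (λ i → *-nonNeg (proj₁ (0<w i)) (0≤c i)) k)

-- Acyclic digraphs and heights.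

module ClosedWalks (em : ExcludedMiddle 0ℓ) where
  open Digraph

  IsWalk : Rel ℕ 0ℓ → ℕ → (ℕ → ℕ) → Set
  IsWalk E k f = ∀ {i} → i <ⁿ k → E (f i) (f (suc i))

  -- A shortest closed walk repeats no vertex.
  closedWalk⇒cycle : ∀ {E} k → Acc _<ⁿ_ k → ∀ f → IsWalk E k f → E (f k) (f 0) → Cycle E
  closedWalk⇒cycle {E} k (acc shorter) f walk close
    with em {∃[ i ] ∃[ j ] i <ⁿ j × j ≤ⁿ k × f i ≡ f j}
  ... | yes (i , suc j , s≤s i≤j , j<k , fi≡fj) =
    -- The segment between the visits at `i` and `suc j`. Its closing arc is the one leaving `f j`,
    -- so the parameter `j ∸ i` is below `k` even for `i = 0`.
    closedWalk⇒cycle (j ∸ i) (shorter (ℕₚ.≤-<-trans (ℕₚ.m∸n≤m j i) j<k)) (λ t → f (t +ⁿ i))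
      (λ {t} t<j∸i → walk (ℕₚ.<-trans (ℕₚ.m≤o∸n⇒m+n≤o (suc t) i≤j t<j∸i) j<k))
      (≡.subst₂ E (≡.cong f (≡.sym (ℕₚ.m∸n+n≡m i≤j))) (≡.sym fi≡fj) (walk j<k))
  ... | no simple = record
    { vertex = λ i → f (toℕ i)
    ; distinct = λ {i} {j} fi≡fj → toℕ-injective (injective (toℕ≤pred[n] i) (toℕ≤pred[n] j) fi≡fj)
    ; arc = λ i → ≡.subst (λ m → E (f m) (f (suc (toℕ i)))) (≡.sym (toℕ-inject₁ i)) (walk (toℕ<n i))
    ; closing = ≡.subst (λ m → E (f m) (f 0)) (≡.sym (toℕ-fromℕ k)) close
    }
    where
    injective : ∀ {i j} → i ≤ⁿ k → j ≤ⁿ k → f i ≡ f j → i ≡ j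
    injective {i} {j} i≤k j≤k fi≡fj with ℕₚ.<-cmp i j
    ... | tri< i<j _ _ = contradiction (i , j , i<j , j≤k , fi≡fj) simple
    ... | tri≈ _ i≡j _ = i≡j
    ... | tri> _ _ j<i = contradiction (j , i , j<i , i≤k , ≡.sym fi≡fj) simple

  -- The last arc is kept apart from the walk so that, for `x ≡ y`, it serves as the closing arc.
  unroll : ∀ {E x y} → TransClosure E x y → ∃[ k ] ∃[ f ] f 0 ≡ x × IsWalk E k f × E (f k) y
  unroll {x = x} [ xy ] = 0 , (λ _ → x) , ≡.refl , (λ ()) , xy
  unroll {E} {x} {y} (xz ∷ zy) =
    let k , f , f0≡z , walk , last = unroll zy
    in suc k , cons f , ≡.refl , cons-walk f0≡z walk , last
    where
    cons : (ℕ → ℕ) → ℕ → ℕ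
    cons f zero    = x
    cons f (suc i) = f i

    cons-walk : ∀ {k f} → f 0 ≡ _ → IsWalk E k f → IsWalk E (suc k) (cons f)
    cons-walk f0≡z walk {zero}  _         = ≡.subst (E x) (≡.sym f0≡z) xz
    cons-walk f0≡z walk {suc i} (s≤s i<k) = walk i<k

  acyclic⇒irreflexive⁺ : ∀ {E} → ¬ Cycle E → ∀ {x} → ¬ TransClosure E x x
  acyclic⇒irreflexive⁺ {E} acyclic x⁺x =
    let k , f , f0≡x , walk , last = unroll x⁺x
    in acyclic (closedWalk⇒cycle k (<-wellFounded k) f walk (≡.subst (E (f k)) (≡.sym f0≡x) last))

  -- Excluded middle turns any predicate into a finite subset, so that heights can be cardinalities.
  comprehension : ∀ {n} → (Fin n → Set) → Subset n
  comprehension P = tabulate λ i → does (em {P i})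

  ∈-comprehension⁺ : ∀ {n} (P : Fin n → Set) {i} → P i → i ∈ˢ comprehension P
  ∈-comprehension⁺ P {i} Pi =
    lookup⇒[]= i _ (≡.trans (lookup∘tabulate _ i) (dec-true em Pi))

  ∈-comprehension⁻ : ∀ {n} (P : Fin n → Set) {i} → i ∈ˢ comprehension P → P i
  ∈-comprehension⁻ P {i} i∈ = witness em (≡.trans (≡.sym (lookup∘tabulate _ i)) ([]=⇒lookup i∈))
    where
    witness : ∀ {A : Set} (A? : Dec A) → does A? ≡ true → A
    witness (yes a) _ = a

  -- At least one arc is required, so in an acyclic digraph no vertex reaches itself. Paths may
  -- leave the range of `s`; only their endpoints are counted.
  reachable : ∀ {n} → Rel ℕ 0ℓ → (Fin n → ℕ) → ℕ → Subset n
  reachable E s x = comprehension λ j → TransClosure E x (s j)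

  height : ∀ {n} → Rel ℕ 0ℓ → (Fin n → ℕ) → ℕ → ℕ
  height E s x = ∣ reachable E s x ∣

  height≤n : ∀ {n} E (s : Fin n → ℕ) x → height E s x ≤ⁿ n
  height≤n E s x = ∣p∣≤n (reachable E s x)

  -- Whatever `s j` reaches, `x` reaches through it; the inclusion is strict because `s j` itself is
  -- reached from `x` but, by acyclicity, not from `s j`.
  height-decreasing : ∀ {E} → ¬ Cycle E → ∀ {n} (s : Fin n → ℕ) {x} j →
                      E x (s j) → height E s (s j) <ⁿ height E s x
  height-decreasing {E} acyclic s {x} j x→sj = p⊂q⇒∣p∣<∣q∣
    ( (λ k∈ → ∈-comprehension⁺ (from x) (x→sj ∷ ∈-comprehension⁻ (from (s j)) k∈))
    , j , ∈-comprehension⁺ (from x) [ x→sj ]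
    , λ j∈ → acyclic⇒irreflexive⁺ acyclic (∈-comprehension⁻ (from (s j)) j∈))
    where
    from : ℕ → Fin _ → Set
    from y k = TransClosure E y (s k)

-- One-sided limits and series of non-negative terms.

module Series (em : ExcludedMiddle 0ℓ) (R : Reals) where
  open OrderedField em R
  open RealMatrix R hiding (sum; _·_; _^_)

  infix 4 _⇑_

  -- "l ≤ lim inf f": the half of f ⟶ l that survives termwise estimates.
  _⇑_ : (ℕ → Carrier) → Carrier → Set
  f ⇑ l = ∀ ε → 0# < ε → ∃[ N ] ∀ n → N ≤ⁿ n → l ≤ f n + ε

  half : ∀ {ε} → 0# < ε → ∃[ h ] 0# < h × h + h ≈ ε
  half {ε} 0<ε =
    let w , 0<w , 2w≈1 = inverse⁺ (<-≤-trans 0<1 (x≤x+y 0≤1))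
    in ε * w , *-pos 0<ε 0<w , (begin-equality
      ε * w + ε * w         ≈⟨ distribˡ ε w w ⟨
      ε * (w + w)           ≈⟨ *-congˡ (+-cong (*-identityˡ w) (*-identityˡ w)) ⟨
      ε * (1# * w + 1# * w) ≈⟨ *-congˡ (distribʳ w 1# 1#) ⟨
      ε * ((1# + 1#) * w)   ≈⟨ *-congˡ 2w≈1 ⟩
      ε * 1#                ≈⟨ *-identityʳ ε ⟩
      ε                     ∎)

  ⟶⇒⇑ : ∀ {f l} → f ⟶ l → f ⇑ l
  ⟶⇒⇑ {f} {l} f⟶l ε 0<ε =
    let N , close = f⟶l ε 0<ε
    in N , λ n N≤n → begin
      l                          ≈⟨ +-identityˡ l ⟨
      0# + l                     ≈⟨ +-congʳ (-‿inverseˡ ε) ⟨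
      - ε + ε + l                ≤⟨ +-monoˡ-≤ l (+-monoˡ-≤ ε (proj₁ (proj₁ (close n N≤n)))) ⟩
      f n - l + ε + l            ≈⟨ solve 3 (λ a b c → a :+ b :+ c := a :+ c :+ b) refl (f n - l) ε l ⟩
      f n - l + l + ε            ≈⟨ +-congʳ (x-y+y≈x (f n) l) ⟩
      f n + ε                    ∎

  ⇑-const : ∀ c → (λ _ → c) ⇑ c
  ⇑-const c ε 0<ε = 0 , λ _ _ → x≤x+y (proj₁ 0<ε)

  ⇑-+ : ∀ {f g a b} → f ⇑ a → g ⇑ b → (λ n → f n + g n) ⇑ a + b
  ⇑-+ {f} {g} {a} {b} f⇑a g⇑b ε 0<ε =
    let h , 0<h , h+h≈ε = half 0<ε
        N₁ , p₁ = f⇑a h 0<h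
        N₂ , p₂ = g⇑b h 0<h
    in N₁ ⊔ N₂ , λ n N≤n → begin
      a + b                    ≤⟨ +-mono-≤ (p₁ n (ℕₚ.m⊔n≤o⇒m≤o N₁ N₂ N≤n)) (p₂ n (ℕₚ.m⊔n≤o⇒n≤o N₁ N₂ N≤n)) ⟩
      (f n + h) + (g n + h)    ≈⟨ solve 3 (λ x y h → (x :+ h) :+ (y :+ h) := x :+ y :+ (h :+ h)) refl (f n) (g n) h ⟩
      f n + g n + (h + h)      ≈⟨ +-congˡ h+h≈ε ⟩
      f n + g n + ε            ∎

  ⇑-* : ∀ {f a c} → 0# ≤ c → f ⇑ a → (λ n → f n * c) ⇑ a * c
  ⇑-* {f} {a} {c} 0≤c f⇑a ε 0<ε =
    -- Division is by `c + 1#`, since `c` may vanish.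
    let w , 0<w , cw≈1 = inverse⁺ (<-≤-trans 0<1 (x≤y+x 0≤c))
        N , p = f⇑a (ε * w) (*-pos 0<ε 0<w)
    in N , λ n N≤n → begin
      a * c                       ≤⟨ *-monoˡ-≤ 0≤c (p n N≤n) ⟩
      (f n + ε * w) * c           ≈⟨ solve 4 (λ x e w c → (x :+ e :* w) :* c := x :* c :+ e :* (c :* w)) refl (f n) ε w c ⟩
      f n * c + ε * (c * w)       ≤⟨ +-monoʳ-≤ _ (*-monoʳ-≤ (proj₁ 0<ε) (*-monoˡ-≤ (proj₁ 0<w) (x≤x+y 0≤1))) ⟩
      f n * c + ε * ((c + 1#) * w) ≈⟨ +-congˡ (trans (*-congˡ cw≈1) (*-identityʳ ε)) ⟩
      f n * c + ε                 ∎

  ⇑-sum : ∀ {k} {f : Fin k → ℕ → Carrier} {a : Vector Carrier k} →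
          (∀ i → f i ⇑ a i) → (λ n → sum (λ i → f i n)) ⇑ sum a
  ⇑-sum {zero}  f⇑a = ⇑-const 0#
  ⇑-sum {suc k} f⇑a = ⇑-+ (f⇑a zero) (⇑-sum (f⇑a ∘ suc))

  ⇑-≤ : ∀ {f a b} → f ⇑ a → (∀ n → f n ≤ b) → a ≤ b
  ⇑-≤ {f} {a} {b} f⇑a f≤b with em {a ≤ b}
  ... | yes a≤b = a≤b
  ... | no a≰b =
    let b≤a , b≉a = ≰⇒> a≰b
        d , 0<d , a≈b+d = ≤∧≉⇒∃+ b≤a b≉a
        h , 0<h , h+h≈d = half 0<d
        N , p = f⇑a h 0<h
    in contradiction (begin
      b + h + h     ≈⟨ +-assoc b h h ⟩
      b + (h + h)   ≈⟨ +-congˡ h+h≈d ⟩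
      b + d         ≈⟨ a≈b+d ⟨
      a             ≤⟨ p N ℕₚ.≤-refl ⟩
      f N + h       ≤⟨ +-monoˡ-≤ h (f≤b N) ⟩
      b + h         ∎) (x+y≰x 0<h)

  monotone⇒≤limit : ∀ {f l} → (∀ {m n} → m ≤ⁿ n → f m ≤ f n) → f ⟶ l → ∀ m → f m ≤ l
  monotone⇒≤limit {f} {l} mono f⟶l m with em {f m ≤ l}
  ... | yes fm≤l = fm≤l
  ... | no fm≰l =
    let l≤fm , l≉fm = ≰⇒> fm≰l
        d , 0<d , fm≈l+d = ≤∧≉⇒∃+ l≤fm l≉fm
        N , close = f⟶l d 0<d
        n = N ⊔ m
    in contradiction (+-cancelʳ-≤ l (begin
      d + l         ≈⟨ +-comm d l ⟩
      l + d         ≈⟨ fm≈l+d ⟨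
      f m           ≤⟨ mono (ℕₚ.m≤n⊔m N m) ⟩
      f n           ≈⟨ x-y+y≈x (f n) l ⟨
      f n - l + l   ∎)) (<⇒≱ (proj₂ (close n (ℕₚ.m≤m⊔n N m))))

  partialSum-mono : ∀ {f : ℕ → Carrier} → (∀ k → 0# ≤ f k) → ∀ {m n} → m ≤ⁿ n →
                    sum {m} (f ∘ toℕ) ≤ sum {n} (f ∘ toℕ)
  partialSum-mono 0≤f {n = n} z≤n = sum-nonNeg {n} (λ i → 0≤f (toℕ i))
  partialSum-mono 0≤f         (s≤s m≤n) = +-monoʳ-≤ _ (partialSum-mono (0≤f ∘ suc) m≤n)

  partialSum≤ : ∀ {f : ℕ → Carrier} {t} → (∀ k → 0# ≤ f k) → HasSum f t → ∀ n → sum {n} (f ∘ toℕ) ≤ t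
  partialSum≤ 0≤f = monotone⇒≤limit (partialSum-mono 0≤f)

  term≤HasSum : ∀ {f : ℕ → Carrier} {t} → (∀ k → 0# ≤ f k) → HasSum f t → ∀ k → f k ≤ t
  term≤HasSum {f} {t} 0≤f hasSum k = begin
    f k                           ≡⟨ ≡.cong f (toℕ-fromℕ k) ⟨
    f (toℕ (fromℕ k))             ≤⟨ term≤sum {suc k} (λ i → 0≤f (toℕ i)) (fromℕ k) ⟩
    sum {suc k} (f ∘ toℕ)         ≤⟨ partialSum≤ 0≤f hasSum (suc k) ⟩
    t                             ∎

  -- Induction on `N`: either `s` starts at 0 and the leading terms agree, or 0 is missed and `f 0`
  -- is an extra summand on the right. In both cases the remaining indices are positive, and the
  -- companion lemma shifts them down by one.
  subsum≤partialSum : ∀ N {n} {f : ℕ → Carrier} {s : Fin n → ℕ} → (∀ k → 0# ≤ f k) →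
    StrictlyIncreasing s → (∀ i → s i <ⁿ N) → sum (f ∘ s) ≤ sum {N} (f ∘ toℕ)
  shifted-subsum≤partialSum : ∀ N {n} {f : ℕ → Carrier} {s : Fin n → ℕ} → (∀ k → 0# ≤ f k) →
    StrictlyIncreasing s → (∀ i → 0 <ⁿ s i) → (∀ i → s i <ⁿ suc N) →
    sum (f ∘ s) ≤ sum {N} (f ∘ suc ∘ toℕ)

  subsum≤partialSum N       {zero}  0≤f s↑ s<N = sum-nonNeg {N} (λ i → 0≤f (toℕ i))
  subsum≤partialSum zero    {suc n} 0≤f s↑ s<N = contradiction (s<N zero) λ ()
  subsum≤partialSum (suc N) {suc n} {f} {s} 0≤f s↑ s<N with s zero in s0≡
  ... | zero = +-mono-≤ ≤-refl
    (shifted-subsum≤partialSum N 0≤f (λ i<j → s↑ (s≤s i<j))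
      (λ i → ≡.subst (_<ⁿ s (suc i)) s0≡ (s↑ (s≤s z≤n))) (s<N ∘ suc))
  ... | suc m = ≤-trans
    (≤-trans (reflexive (+-congʳ (≈-reflexive (≡.cong f (≡.sym s0≡)))))
      (shifted-subsum≤partialSum N 0≤f s↑ 0<s s<N))
    (x≤y+x (0≤f 0))
    where
    0<s : ∀ i → 0 <ⁿ s i
    0<s zero    = ≡.subst (0 <ⁿ_) (≡.sym s0≡) (s≤s z≤n)
    0<s (suc i) = ℕₚ.<-trans (0<s zero) (s↑ (s≤s z≤n))

  shifted-subsum≤partialSum N {f = f} {s} 0≤f s↑ 0<s s≤N = begin
    sum (λ i → f (s i))          ≈⟨ sum-cong-≋ (λ i → ≈-reflexive (≡.cong f (ℕₚ.suc-pred (s i) {{>-nonZero (0<s i)}}))) ⟨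
    sum (λ i → f (suc (pred (s i)))) ≤⟨ subsum≤partialSum N (0≤f ∘ suc)
                                      (λ {i} i<j → ℕₚ.pred-mono-< {{>-nonZero (0<s i)}} (s↑ i<j))
                                      (λ i → ℕₚ.pred-mono-< {{>-nonZero (0<s i)}} (s≤N i)) ⟩
    sum {N} (f ∘ suc ∘ toℕ)      ∎

  strictUpperBound : ∀ {n} (s : Fin n → ℕ) → ∃[ N ] ∀ i → s i <ⁿ N
  strictUpperBound {zero}  s = 0 , λ ()
  strictUpperBound {suc n} s =
    let N , s<N = strictUpperBound (s ∘ suc)
    in suc (s zero) ⊔ N , λ where
      zero    → ℕₚ.m≤m⊔n (suc (s zero)) N
      (suc i) → ℕₚ.≤-trans (s<N i) (ℕₚ.m≤n⊔m (suc (s zero)) N)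

  subsum≤HasSum : ∀ {n} {f : ℕ → Carrier} {t} {s : Fin n → ℕ} → (∀ k → 0# ≤ f k) → HasSum f t →
                  StrictlyIncreasing s → sum (f ∘ s) ≤ t
  subsum≤HasSum {s = s} 0≤f hasSum s↑ =
    let N , s<N = strictUpperBound s
    in ≤-trans (subsum≤partialSum N 0≤f s↑ s<N) (partialSum≤ 0≤f hasSum N)

  ^-pos : ∀ {x} → 0# < x → ∀ p → 0# < x ^ p
  ^-pos 0<x zero    = 0<1
  ^-pos 0<x (suc p) = *-pos 0<x (^-pos 0<x p)

  identity-diagonal : ∀ v → identity v v ≈ 1#
  identity-diagonal v with v ℕₚ.≟ v
  ... | yes _  = refl
  ... | no v≢v = contradiction ≡.refl v≢v

  identity-nonNeg : NonNegative identity
  identity-nonNeg v w with v ℕₚ.≟ w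
  ... | yes _ = 0≤1
  ... | no  _ = ≤-refl

  -- The Green function of `M` at `l`.

  module Green
    {M : Matrix} (0≤M : NonNegative M)
    {l y : Carrier} (0<y : 0# < y) (0≤l : 0# ≤ l) (ly≈1 : l * y ≈ 1#)
    {P : ℕ → Matrix} (powers : IsPowers M P)
    (conv : ∀ v w → ∃[ s ] HasSum (λ p → P p v w * y ^ p) s)
    where

    open IsPowers powers

    G : Matrix
    G v w = proj₁ (conv v w)

    P-nonNeg : ∀ p → NonNegative (P p)
    P-nonNeg zero    v w = ≤-trans (identity-nonNeg v w) (reflexive (sym (base v w)))
    P-nonNeg (suc p) v w = partialSum≤ (λ u → *-nonNeg (P-nonNeg p v u) (0≤M u w)) (step p v w) 0

    term-nonNeg : ∀ v w p → 0# ≤ P p v w * y ^ p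
    term-nonNeg v w p = *-nonNeg (P-nonNeg p v w) (proj₁ (^-pos 0<y p))

    P-step : ∀ p v w {n} {s : Fin n → ℕ} → StrictlyIncreasing s →
             sum (λ i → P p v (s i) * M (s i) w) ≤ P (suc p) v w
    P-step p v w = subsum≤HasSum (λ u → *-nonNeg (P-nonNeg p v u) (0≤M u w)) (step p v w)

    -- Truncation leaves only finite sums to interchange. Multiplying by `M` raises the power by
    -- one, at the price of a factor `l` because `l * y ≈ 1#`; the term `l * identity v w` fills the
    -- vacant place `p = 0`. Hence `suc N` terms on the right.
    truncated-G-step : ∀ N v w {n} {s : Fin n → ℕ} → StrictlyIncreasing s →
      sum (λ i → sum {N} (λ p → P (toℕ p) v (s i) * y ^ toℕ p) * M (s i) w) + l * identity v w ≤ l * G v w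
    truncated-G-step N v w {n} {s} s↑ = begin
      sum (λ i → sum {N} (λ p → P (toℕ p) v (s i) * y ^ toℕ p) * M (s i) w) + l * identity v w
        ≈⟨ +-cong (sum-cong-≋ (λ i → *-distribʳ-sum (M (s i) w) (λ (p : Fin N) → P (toℕ p) v (s i) * y ^ toℕ p)))
             (*-congˡ (trans (sym (base v w)) (sym (*-identityʳ _)))) ⟩
      sum (λ i → sum {N} (λ p → P (toℕ p) v (s i) * y ^ toℕ p * M (s i) w)) + l * first
        ≈⟨ +-congʳ (∑-comm (λ i (p : Fin N) → P (toℕ p) v (s i) * y ^ toℕ p * M (s i) w)) ⟩
      sum {N} (λ p → sum (λ i → P (toℕ p) v (s i) * y ^ toℕ p * M (s i) w)) + l * first
        ≤⟨ +-monoˡ-≤ _ (sum-mono {N} (λ p → advance (toℕ p))) ⟩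
      sum {N} (λ p → l * (P (suc (toℕ p)) v w * y ^ suc (toℕ p))) + l * first
        ≈⟨ +-congʳ (*-distribˡ-sum l (λ (p : Fin N) → P (suc (toℕ p)) v w * y ^ suc (toℕ p))) ⟨
      l * rest + l * first
        ≈⟨ trans (sym (distribˡ l rest first)) (*-congˡ (+-comm rest first)) ⟩
      l * sum {suc N} (λ p → P (toℕ p) v w * y ^ toℕ p)
        ≤⟨ *-monoʳ-≤ 0≤l (partialSum≤ (term-nonNeg v w) (proj₂ (conv v w)) (suc N)) ⟩
      l * G v w ∎
      where
      first = P 0 v w * 1#
      rest = sum {N} (λ p → P (suc (toℕ p)) v w * y ^ suc (toℕ p))

      advance : ∀ p → sum (λ i → P p v (s i) * y ^ p * M (s i) w) ≤ l * (P (suc p) v w * y ^ suc p)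
      advance p = begin
        sum (λ i → P p v (s i) * y ^ p * M (s i) w)
          ≈⟨ sum-cong-≋ (λ i → solve 3 (λ a b c → a :* b :* c := a :* c :* b) refl (P p v (s i)) (y ^ p) (M (s i) w)) ⟩
        sum (λ i → P p v (s i) * M (s i) w * y ^ p)
          ≈⟨ *-distribʳ-sum (y ^ p) (λ i → P p v (s i) * M (s i) w) ⟨
        sum (λ i → P p v (s i) * M (s i) w) * y ^ p
          ≤⟨ *-monoˡ-≤ (proj₁ (^-pos 0<y p)) (P-step p v w s↑) ⟩
        P (suc p) v w * y ^ p
          ≈⟨ trans (*-congʳ ly≈1) (*-identityˡ _) ⟨
        l * y * (P (suc p) v w * y ^ p)
          ≈⟨ solve 4 (λ l y a b → l :* y :* (a :* b) := l :* (a :* (y :* b))) refl l y (P (suc p) v w) (y ^ p) ⟩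
        l * (P (suc p) v w * y ^ suc p) ∎

    -- Let `N` grow in the truncated bound: the right side is free of `N`, and on the left finitely
    -- many series are scaled by non-negative constants, so lower limits suffice.
    G-step : ∀ v w {n} {s : Fin n → ℕ} → StrictlyIncreasing s →
      sum (λ i → G v (s i) * M (s i) w) + l * identity v w ≤ l * G v w
    G-step v w {s = s} s↑ = ⇑-≤
      (⇑-+ (⇑-sum (λ i → ⇑-* (0≤M (s i) w) (⟶⇒⇑ (proj₂ (conv v (s i)))))) (⇑-const (l * identity v w)))
      (λ N → truncated-G-step N v w s↑)

    P-pos : ∀ {v a b p} → 0# < P p v a → Star (Arc M) a b → ∃[ q ] 0# < P q v b
    P-pos {p = p} 0<Pva [] = p , 0<Pva
    P-pos {v} {p = p} 0<Pva (_◅_ {a} {c} a→c c→*b) = P-pos {p = suc p} 0<Pvc c→*b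
      where
      0<Pvc : 0# < P (suc p) v c
      0<Pvc = <-≤-trans (*-pos 0<Pva (0≤M a c , a→c ∘ sym))
        (term≤HasSum (λ u → *-nonNeg (P-nonNeg p v u) (0≤M u c)) (step p v c) a)

    G-pos : Irreducible M → ∀ v w → 0# < G v w
    G-pos irreducible v w = <-≤-trans (*-pos (proj₂ positive) (^-pos 0<y (proj₁ positive)))
        (term≤HasSum (term-nonNeg v w) (proj₂ (conv v w)) (proj₁ positive))
      where
      0<Pvv : 0# < P 0 v v
      0<Pvv = <-≤-trans 0<1 (reflexive (trans (sym (identity-diagonal v)) (sym (base v v))))

      positive : ∃[ p ] 0# < P p v w
      positive with v ℕₚ.≟ w
      ... | yes ≡.refl = 0 , 0<Pvv
      ... | no v≢w     = P-pos {p = 0} 0<Pvv (irreducible v w v≢w)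

-- The spectral gap of finite submatrices, and recurrence.

module Recurrence (em : ExcludedMiddle 0ℓ) (R : Reals) where
  open OrderedField em R
  open SpectralBound em R using (modulus≤)
  open ClosedWalks em
  open Series em R
  open RealMatrix R hiding (sum; _·_; _^_)
  open Digraph

  ·-mono-≤ : ∀ k {x y} → x ≤ y → k · x ≤ k · y
  ·-mono-≤ zero    x≤y = ≤-refl
  ·-mono-≤ (suc k) x≤y = +-mono-≤ x≤y (·-mono-≤ k x≤y)

  ·-nonNeg : ∀ k {x} → 0# ≤ x → 0# ≤ k · x
  ·-nonNeg zero    0≤x = ≤-refl
  ·-nonNeg (suc k) 0≤x = +-nonNeg 0≤x (·-nonNeg k 0≤x)

  ·-assoc-* : ∀ k x y → (k · x) * y ≈ k · (x * y)
  ·-assoc-* zero    x y = zeroˡ y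
  ·-assoc-* (suc k) x y = trans (distribʳ y x (k · x)) (+-congˡ (·-assoc-* k x y))

  ·-cancel-≤ : ∀ k {x y} → suc k · x ≤ suc k · y → x ≤ y
  ·-cancel-≤ k {x} {y} p = *-cancelʳ-≤ (<-≤-trans 0<1 (x≤x+y (·-nonNeg k 0≤1))) (begin
    x * (suc k · 1#)   ≈⟨ as-multiple x ⟩
    suc k · x          ≤⟨ p ⟩
    suc k · y          ≈⟨ as-multiple y ⟨
    y * (suc k · 1#)   ∎)
    where
    ·-congʳ : ∀ k {x y} → x ≈ y → k · x ≈ k · y
    ·-congʳ zero    x≈y = refl
    ·-congʳ (suc k) x≈y = +-cong x≈y (·-congʳ k x≈y)

    as-multiple : ∀ z → z * (suc k · 1#) ≈ suc k · z
    as-multiple z = trans (*-comm z _) (trans (·-assoc-* (suc k) 1# z) (·-congʳ (suc k) (*-identityˡ z)))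

  divide : ∀ k {δ} → 0# < δ → ∃[ η ] 0# < η × suc k · η ≈ δ
  divide k {δ} 0<δ =
    -- The number inverted is `suc k · δ`, positive because `δ` is its first summand; hence
    -- `δ * w * δ` is `δ / (k + 1)`.
    let w , 0<w , kw≈1 = inverse⁺ (<-≤-trans 0<δ (x≤x+y (·-nonNeg k (proj₁ 0<δ))))
    in δ * w * δ , *-pos (*-pos 0<δ 0<w) 0<δ , (begin-equality
      suc k · (δ * w * δ)    ≈⟨ ·-assoc-* (suc k) (δ * w) δ ⟨
      (suc k · (δ * w)) * δ  ≈⟨ *-congʳ (trans (sym (·-assoc-* (suc k) δ w)) kw≈1) ⟩
      1# * δ                 ≈⟨ *-identityˡ δ ⟩
      δ                      ∎)

  ^-antitone : ∀ {θ} → 0# < θ → θ ≤ 1# → ∀ {i j} → i ≤ⁿ j → θ ^ j ≤ θ ^ i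
  ^-antitone 0<θ θ≤1 {j = zero} z≤n = ≤-refl
  ^-antitone {θ} 0<θ θ≤1 {j = suc j} z≤n = begin
    θ * θ ^ j   ≤⟨ *-mono-≤ 0≤1 (proj₁ (^-pos 0<θ j)) θ≤1 (^-antitone 0<θ θ≤1 {j = j} z≤n) ⟩
    1# * 1#     ≈⟨ *-identityˡ 1# ⟩
    1#          ∎
  ^-antitone 0<θ θ≤1 (s≤s i≤j) = *-monoʳ-≤ (proj₁ 0<θ) (^-antitone 0<θ θ≤1 i≤j)

  bernoulli : ∀ {θ η} → 0# ≤ θ → 0# ≤ η → θ + η ≈ 1# → ∀ k → 1# ≤ θ ^ k + k · η
  bernoulli 0≤θ 0≤η θ+η≈1 zero = x≤x+y ≤-refl
  bernoulli {θ} {η} 0≤θ 0≤η θ+η≈1 (suc k) = begin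
    1#                                ≈⟨ θ+η≈1 ⟨
    θ + η                             ≈⟨ +-congʳ (*-identityʳ θ) ⟨
    θ * 1# + η                        ≤⟨ +-monoˡ-≤ η (*-monoʳ-≤ 0≤θ (bernoulli 0≤θ 0≤η θ+η≈1 k)) ⟩
    θ * (θ ^ k + k · η) + η           ≈⟨ +-congʳ (distribˡ θ _ _) ⟩
    θ * θ ^ k + θ * (k · η) + η       ≤⟨ +-monoˡ-≤ η (+-monoʳ-≤ _ (*-monoˡ-≤ (·-nonNeg k 0≤η) θ≤1)) ⟩
    θ * θ ^ k + 1# * (k · η) + η      ≈⟨ +-congʳ (+-congˡ (*-identityˡ _)) ⟩
    θ * θ ^ k + k · η + η             ≈⟨ solve 3 (λ a b c → a :+ b :+ c := a :+ (c :+ b)) refl (θ * θ ^ k) (k · η) η ⟩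
    θ * θ ^ k + (η + k · η)           ∎
    where
    θ≤1 : θ ≤ 1#
    θ≤1 = ≤-trans (x≤x+y 0≤η) (reflexive θ+η≈1)

  -- An arc ending outside F gains a factor θ because e drops along it; one ending
  -- in F gains θ^(n+2) from the defect of u there.
  module WeightedSubmatrix
    {M : Matrix} (0≤M : NonNegative M) {F : List ℕ} (acyclic : IsCycleTransversal (Arc M) F)
    {l : Carrier} (0≤l : 0# ≤ l)
    {u : ℕ → Carrier} (0<u : ∀ x → 0# < u x)
    {n : ℕ} {s : Fin n → ℕ}
    (superharmonic : ∀ x → sum (λ i → u (s i) * M (s i) x) ≤ l * u x)
    (defect : ∀ x → x ∈ F → sum (λ i → u (s i) * M (s i) x) + l ≤ l * u x)
    {δ : Carrier} (uδ≤1 : ∀ x → x ∈ F → u x * δ ≤ 1#)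
    {θ : Carrier} (0<θ : 0# < θ) (θ≤1 : θ ≤ 1#)
    (1≤θ^+δ : 1# ≤ θ ^ suc (suc n) + δ)
    where

    -- The decision is an argument so that case analysis on it makes the exponent reduce. Heights
    -- are at most `n`, so the value `suc n` lets the exponent drop along arcs leaving `F` too.
    exponent : ∀ x → Dec (x ∈ F) → ℕ
    exponent x (yes _) = suc n
    exponent x (no _)  = height (delete F (Arc M)) s x

    e : ℕ → ℕ
    e x = exponent x em

    weight : Vector Carrier n
    weight i = u (s i) * θ ^ e (s i)

    columns : ∀ j (d : Dec (s j ∈ F)) →
      sum (λ i → weight i * M (s i) (s j)) ≤ l * θ * (u (s j) * θ ^ exponent (s j) d)
    columns j (yes x∈F) = +-cancelʳ-≤ l (begin
      sum (λ i → weight i * M (s i) x) + l      ≤⟨ +-monoˡ-≤ l (sum-mono drop-power) ⟩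
      sum (λ i → u (s i) * M (s i) x) + l       ≤⟨ defect x x∈F ⟩
      l * u x                                   ≈⟨ *-identityʳ _ ⟨
      -- Splitting `1#` gives two parts: the power of `θ` produces the desired right side, and the
      -- `δ` part is at most `l`, which the defect on the left cancels.
      l * u x * 1#                              ≤⟨ *-monoʳ-≤ (*-nonNeg 0≤l (proj₁ (0<u x))) 1≤θ^+δ ⟩
      l * u x * (θ * θ ^ suc n + δ)
        ≈⟨ solve 5 (λ l u t a d → l :* u :* (t :* a :+ d) := l :* t :* (u :* a) :+ l :* (u :* d)) refl l (u x) θ (θ ^ suc n) δ ⟩
      l * θ * (u x * θ ^ suc n) + l * (u x * δ) ≤⟨ +-monoʳ-≤ _ (*-monoʳ-≤ 0≤l (uδ≤1 x x∈F)) ⟩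
      l * θ * (u x * θ ^ suc n) + l * 1#        ≈⟨ +-congˡ (*-identityʳ l) ⟩
      l * θ * (u x * θ ^ suc n) + l             ∎)
      where
      x = s j
      drop-power : ∀ i → weight i * M (s i) x ≤ u (s i) * M (s i) x
      drop-power i = *-monoˡ-≤ (0≤M (s i) x) (begin
        u (s i) * θ ^ e (s i)   ≤⟨ *-monoʳ-≤ (proj₁ (0<u (s i))) (^-antitone 0<θ θ≤1 {j = e (s i)} z≤n) ⟩
        u (s i) * 1#            ≈⟨ *-identityʳ _ ⟩
        u (s i)                 ∎)
    columns j (no x∉F) = begin
      sum (λ i → weight i * M (s i) x)                      ≤⟨ sum-mono drop-power ⟩
      sum (λ i → θ ^ suc h * (u (s i) * M (s i) x))         ≈⟨ *-distribˡ-sum (θ ^ suc h) (λ i → u (s i) * M (s i) x) ⟨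
      θ ^ suc h * sum (λ i → u (s i) * M (s i) x)           ≤⟨ *-monoʳ-≤ (proj₁ (^-pos 0<θ (suc h))) (superharmonic x) ⟩
      θ * θ ^ h * (l * u x)
        ≈⟨ solve 4 (λ l u t a → t :* a :* (l :* u) := l :* t :* (u :* a)) refl l (u x) θ (θ ^ h) ⟩
      l * θ * (u x * θ ^ h)                                 ∎
      where
      x = s j
      h = height (delete F (Arc M)) s x

      gain : ∀ i (d : Dec (s i ∈ F)) → Arc M (s i) x → suc h ≤ⁿ exponent (s i) d
      gain i (yes _)    _    = s≤s (height≤n _ s x)
      gain i (no si∉F) si→x = height-decreasing acyclic s j (si∉F , x∉F , si→x)

      drop-power : ∀ i → weight i * M (s i) x ≤ θ ^ suc h * (u (s i) * M (s i) x)
      -- The exponent is known to drop only along arcs; where the entry vanishes, both sides are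
      -- compared with zero instead.
      drop-power i with em {M (s i) x ≈ 0#}
      ... | yes M≈0 = begin
        weight i * M (s i) x                 ≈⟨ trans (*-congˡ M≈0) (zeroʳ _) ⟩
        0#                                   ≤⟨ *-nonNeg (proj₁ (^-pos 0<θ (suc h))) (*-nonNeg (proj₁ (0<u (s i))) (0≤M (s i) x)) ⟩
        θ ^ suc h * (u (s i) * M (s i) x)    ∎
      ... | no si→x = begin
        u (s i) * θ ^ e (s i) * M (s i) x
          ≤⟨ *-monoˡ-≤ (0≤M (s i) x) (*-monoʳ-≤ (proj₁ (0<u (s i))) (^-antitone 0<θ θ≤1 (gain i em si→x))) ⟩
        u (s i) * θ ^ suc h * M (s i) x
          ≈⟨ solve 3 (λ u a m → u :* a :* m := a :* (u :* m)) refl (u (s i)) (θ ^ suc h) (M (s i) x) ⟩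
        θ ^ suc h * (u (s i) * M (s i) x)    ∎

    spectralRadius≤ : ∀ {ρ} → IsSpectralRadius (submatrix M s) ρ → ρ ≤ l * θ
    spectralRadius≤ ((μ , eigenvalue , modulus) , _) =
      modulus≤ (submatrix M s) weight (λ i j → 0≤M (s i) (s j))
        (λ i → *-pos (0<u (s i)) (^-pos 0<θ (e (s i))))
        (λ j → columns j em) eigenvalue modulus

  -- A supremum of non-negative numbers that exists at all is non-negative,
  -- since every element is an upper bound of the empty set.
  λₙ-nonNeg : ∀ {M n l} → Isλₙ M n l → 0# ≤ l
  λₙ-nonNeg {M} {l = l} (upper , least) with em {0# ≤ l}
  ... | yes 0≤l = 0≤l
  ... | no 0≰l = contradiction
    (≤-trans (reflexive (x-y+y≈x l 1#)) (least (l - 1#) λ where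
      ρ (s , s↑ , ρ-max) → contradiction (≤-trans (proj₁ (proj₂ (proj₂ (proj₁ ρ-max)))) (upper ρ (s , s↑ , ρ-max))) 0≰l))
    (x+y≰x 0<1)

  λ-nonNeg : ∀ {M ls l} → Isλ M ls l → 0# ≤ l
  λ-nonNeg {M} {ls} {l} isλ with em {0# ≤ l}
  ... | yes 0≤l = 0≤l
  ... | no 0≰l =
    let l≤0 , l≉0 = ≰⇒> 0≰l
        d , 0<d , 0≈l+d = ≤∧≉⇒∃+ l≤0 l≉0
        N , close = limit d 0<d
    in contradiction (+-cancelʳ-≤ l (begin
      d + l                   ≈⟨ trans (+-comm d l) (sym 0≈l+d) ⟩
      -- The index is `suc N` because `ls 0` is unconstrained.
      0#                      ≤⟨ λₙ-nonNeg {M} (isλₙ (suc N)) ⟩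
      ls (suc N)              ≈⟨ x-y+y≈x _ l ⟨
      ls (suc N) - l + l      ∎)) (<⇒≱ (proj₂ (close (suc N) (ℕₚ.n≤1+n N))))
    where open Isλ isλ

  -- Stating `u M ≤ l u` through finite families of indices avoids the infinite sums in `u M` and
  -- applies verbatim to principal submatrices.
  LeftSuperharmonic : Matrix → Carrier → (ℕ → Carrier) → Set
  LeftSuperharmonic M l u = ∀ {n} {s : Fin n → ℕ} → StrictlyIncreasing s → ∀ x →
    sum (λ i → u (s i) * M (s i) x) ≤ l * u x

  HasDefectOn : List ℕ → Matrix → Carrier → (ℕ → Carrier) → Set
  HasDefectOn F M l u = ∀ {n} {s : Fin n → ℕ} → StrictlyIncreasing s → ∀ x → x ∈ F →
    sum (λ i → u (s i) * M (s i) x) + l ≤ l * u x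

  -- Every submatrix of order `n` has spectral radius at most `l * θ`, hence so does the supremum,
  -- and `θ = 1# - η` turns this into the gap `η * l`.
  gap : ∀ {M F l u} → NonNegative M → IsCycleTransversal (Arc M) F → 0# ≤ l → (∀ x → 0# < u x) →
    LeftSuperharmonic M l u → HasDefectOn F M l u →
    ∀ {δ} → (∀ x → x ∈ F → u x * δ ≤ 1#) → δ ≤ 1# →
    ∀ n {η} → 0# < η → suc (suc n) · η ≈ δ → ∀ {lₙ} → Isλₙ M n lₙ → η * l ≤ l - lₙ
  gap {M} {F} {l} {u} 0≤M acyclic 0≤l 0<u superharmonic defect {δ} uδ≤1 δ≤1 n {η} 0<η nη≈δ {lₙ} (_ , least) =
    +-cancelʳ-≤ lₙ (begin
      η * l + lₙ       ≤⟨ +-monoʳ-≤ _ (least (l * θ) λ where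
                            ρ (s , s↑ , spectral) → WeightedSubmatrix.spectralRadius≤ 0≤M {F} acyclic 0≤l {u} 0<u
                              (superharmonic s↑) (defect s↑) uδ≤1 0<θ θ≤1 1≤θ^+δ spectral) ⟩
      η * l + l * θ    ≈⟨ solve 3 (λ e l t → e :* l :+ l :* t := l :* (t :+ e)) refl η l θ ⟩
      l * (θ + η)      ≈⟨ trans (*-congˡ θ+η≈1) (*-identityʳ l) ⟩
      l                ≈⟨ x-y+y≈x l lₙ ⟨
      l - lₙ + lₙ      ∎)
    where
    θ = 1# - η

    θ+η≈1 : θ + η ≈ 1#
    θ+η≈1 = x-y+y≈x 1# η

    -- As `suc (suc n) · η ≈ δ ≤ 1#`, removing one `η` from `1#` leaves at least `suc n · η`.
    0<θ : 0# < θ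
    0<θ = ≤∧≱⇒< (≤-trans (·-nonNeg (suc n) (proj₁ 0<η)) nη≤θ) λ θ≤0 →
      <⇒≱ (<-≤-trans 0<η (x≤x+y (·-nonNeg n (proj₁ 0<η)))) (≤-trans nη≤θ θ≤0)
      where
      nη≤θ : suc n · η ≤ θ
      nη≤θ = +-cancelʳ-≤ η (begin
        suc n · η + η    ≈⟨ +-comm _ η ⟩
        suc (suc n) · η  ≈⟨ nη≈δ ⟩
        δ                ≤⟨ δ≤1 ⟩
        1#               ≈⟨ θ+η≈1 ⟨
        θ + η            ∎)

    θ≤1 : θ ≤ 1#
    θ≤1 = ≤-trans (x≤x+y (proj₁ 0<η)) (reflexive θ+η≈1)

    1≤θ^+δ : 1# ≤ θ ^ suc (suc n) + δ
    1≤θ^+δ = begin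
      1#                                    ≤⟨ bernoulli (proj₁ 0<θ) (proj₁ 0<η) θ+η≈1 (suc (suc n)) ⟩
      θ ^ suc (suc n) + suc (suc n) · η     ≈⟨ +-congˡ nη≈δ ⟩
      θ ^ suc (suc n) + δ                   ∎

  positive-defect⇒¬o : ∀ {M F l u} → NonNegative M → IsCycleTransversal (Arc M) F → 0# < l → (∀ x → 0# < u x) →
    LeftSuperharmonic M l u → HasDefectOn F M l u →
    ∀ {δ} → 0# < δ → (∀ x → x ∈ F → u x * δ ≤ 1#) → δ ≤ 1# →
    ∀ {ls} → Isλ M ls l → ¬ IsLittleO[1/n] (λ n → l - ls n)
  positive-defect⇒¬o {l = l} 0≤M acyclic 0<l 0<u superharmonic defect {δ} 0<δ uδ≤1 δ≤1 {ls} isλ little =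
    -- For `n ≥ 1` one has `n / (n + 2) ≥ 1 / 3`, so the gap keeps `n · (l - ls n)` above
    -- `δ * l / 3`, which is this `ε`. In the chain below the ratio appears as
    -- `x + (x + z) ≤ 3 · z`, from `x ≤ z = n · x`.
    let ε , 0<ε , 3ε≈δl = divide 2 (*-pos 0<δ 0<l)
        N , close = little ε 0<ε
        n = suc N
        η , 0<η , nη≈δ = divide (suc n) 0<δ
        T = n · (l - ls n)
        x = η * l
        z = n · x
        x≤z = x≤x+y (·-nonNeg N (*-nonNeg (proj₁ 0<η) (proj₁ 0<l)))
        T<ε = proj₂ (close n (ℕₚ.n≤1+n N))
    in contradiction (·-cancel-≤ 2 (begin
      3 · ε                   ≈⟨ 3ε≈δl ⟩
      δ * l                   ≈⟨ *-congʳ nη≈δ ⟨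
      (suc (suc n) · η) * l   ≈⟨ ·-assoc-* (suc (suc n)) η l ⟩
      x + (x + z)             ≤⟨ +-mono-≤ x≤z (+-mono-≤ x≤z (x≤x+y ≤-refl)) ⟩
      3 · z                   ≤⟨ ·-mono-≤ 3 (·-mono-≤ n (gap 0≤M acyclic (proj₁ 0<l) 0<u superharmonic defect
                                   uδ≤1 δ≤1 n 0<η nη≈δ (Isλ.isλₙ isλ n))) ⟩
      3 · T                   ≤⟨ ·-mono-≤ 3 (reflexive (sym (trans (+-congˡ -0#≈0#) (+-identityʳ T)))) ⟩
      3 · (T - 0#)            ∎)) (<⇒≱ T<ε)

  uniform-scale : ∀ {u : ℕ → Carrier} → (∀ x → 0# < u x) → (F : List ℕ) → ∃[ δ ] 0# < δ × (∀ x → x ∈ F → u x * δ ≤ 1#) × δ ≤ 1#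
  uniform-scale {u} 0<u F =
    let δ , 0<δ , Kδ≈1 = inverse⁺ (<-≤-trans 0<1 (x≤x+y 0≤S))
    in δ , 0<δ
      , (λ x x∈F → begin
          u x * δ                                      ≡⟨ ≡.cong (λ y → u y * δ) (lookup-index x∈F) ⟩
          u (lookup F (index x∈F)) * δ                 ≤⟨ *-monoˡ-≤ (proj₁ 0<δ) (≤-trans (term≤sum 0≤uF (index x∈F)) (x≤y+x 0≤1)) ⟩
          (1# + S) * δ                                 ≈⟨ Kδ≈1 ⟩
          1#                                           ∎)
      , (begin
          δ                                            ≈⟨ *-identityˡ δ ⟨
          1# * δ                                       ≤⟨ *-monoˡ-≤ (proj₁ 0<δ) (x≤x+y 0≤S) ⟩
          (1# + S) * δ                                 ≈⟨ Kδ≈1 ⟩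
          1#                                           ∎)
    where
    S = sum {length F} (λ k → u (lookup F k))

    0≤uF : ∀ k → 0# ≤ u (lookup F k)
    0≤uF k = proj₁ (0<u (lookup F k))

    0≤S : 0# ≤ S
    0≤S = sum-nonNeg 0≤uF

  delete-⊇-acyclic : ∀ {E F x} → IsCycleTransversal E F → IsCycleTransversal E (x ∷ F)
  delete-⊇-acyclic {E} {F} {x} acyclic cycle = acyclic record
    { vertex = vertex
    ; distinct = distinct
    ; arc = λ i → weaken (arc i)
    ; closing = weaken closing
    }
    where
    open Cycle cycle
    weaken : ∀ {v w} → delete (x ∷ F) E v w → delete F E v w
    weaken (v∉ , w∉ , vw) = v∉ ∘ there , w∉ ∘ there , vw

  recurrent : ∀ {M} → NonNegative M → Irreducible M → ∀ {ls l} → Isλ M ls l →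
    HasFiniteCycleTransversal M → IsLittleO[1/n] (λ n → l - ls n) → Recurrent M l
  recurrent {M} 0≤M irreducible {ls} {l} isλ (F₀ , acyclic) little (y , ly≈1 , P , powers , conv) =
    let δ , 0<δ , uδ≤1 , δ≤1 = uniform-scale {u} 0<u F
    in positive-defect⇒¬o {M} {F} {l} {u} 0≤M (delete-⊇-acyclic acyclic) 0<l 0<u superharmonic defect 0<δ uδ≤1 δ≤1 isλ little
    where
    -- The extra vertex makes the transversal non-empty.
    F = 0 ∷ F₀

    0≤l : 0# ≤ l
    0≤l = λ-nonNeg isλ

    0<l : 0# < l
    0<l = 0≤l , λ 0≈l → 0≉1 (trans (sym (zeroˡ y)) (trans (*-congʳ 0≈l) ly≈1))

    0<y : 0# < y
    0<y = (begin
        0#           ≤⟨ *-nonNeg 0≤l (0≤x*x y) ⟩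
        l * (y * y)  ≈⟨ trans (sym (*-assoc l y y)) (*-congʳ ly≈1) ⟩
        1# * y       ≈⟨ *-identityˡ y ⟩
        y            ∎)
      , λ 0≈y → 0≉1 (trans (sym (zeroʳ l)) (trans (*-congˡ 0≈y) ly≈1))

    open Green 0≤M 0<y 0≤l ly≈1 powers conv

    u : ℕ → Carrier
    u x = sum (λ k → G (lookup F k) x)

    0<u : ∀ x → 0# < u x
    0<u x = <-≤-trans (G-pos irreducible 0 x)
      (term≤sum {length F} (λ k → proj₁ (G-pos irreducible (lookup F k) x)) zero)

    -- The sum of identity entries counts how often `x` occurs in the list `F`. It may exceed 1, as
    -- 0 can already lie in `F₀`, so `defect` uses it only as a lower bound.
    u-step : ∀ {n} {s : Fin n → ℕ} → StrictlyIncreasing s → ∀ x →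
      sum (λ i → u (s i) * M (s i) x) + l * sum {length F} (λ k → identity (lookup F k) x) ≤ l * u x
    u-step {s = s} s↑ x = begin
      sum (λ i → u (s i) * M (s i) x) + l * sum {length F} (λ k → identity (lookup F k) x)
        ≈⟨ +-cong (sum-cong-≋ (λ i → *-distribʳ-sum (M (s i) x) (λ k → G (lookup F k) (s i))))
             (*-distribˡ-sum l (λ k → identity (lookup F k) x)) ⟩
      sum (λ i → sum (λ k → G (lookup F k) (s i) * M (s i) x)) + sum (λ k → l * identity (lookup F k) x)
        ≈⟨ +-congʳ (∑-comm (λ i k → G (lookup F k) (s i) * M (s i) x)) ⟩
      sum (λ k → sum (λ i → G (lookup F k) (s i) * M (s i) x)) + sum (λ k → l * identity (lookup F k) x)
        ≈⟨ ∑-distrib-+ (λ k → sum (λ i → G (lookup F k) (s i) * M (s i) x)) (λ k → l * identity (lookup F k) x) ⟨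
      sum (λ k → sum (λ i → G (lookup F k) (s i) * M (s i) x) + l * identity (lookup F k) x)
        ≤⟨ sum-mono (λ k → G-step (lookup F k) x s↑) ⟩
      sum (λ k → l * G (lookup F k) x)
        ≈⟨ *-distribˡ-sum l (λ k → G (lookup F k) x) ⟨
      l * u x ∎

    superharmonic : LeftSuperharmonic M l u
    superharmonic s↑ x = ≤-trans
      (x≤x+y (*-nonNeg 0≤l (sum-nonNeg (λ k → identity-nonNeg (lookup F k) x)))) (u-step s↑ x)

    defect : HasDefectOn F M l u
    defect {s = s} s↑ x x∈F = begin
      sum (λ i → u (s i) * M (s i) x) + l
        ≈⟨ +-congˡ (*-identityʳ l) ⟨
      sum (λ i → u (s i) * M (s i) x) + l * 1#
        ≤⟨ +-monoʳ-≤ _ (*-monoʳ-≤ 0≤l 1≤) ⟩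
      sum (λ i → u (s i) * M (s i) x) + l * sum {length F} (λ k → identity (lookup F k) x)
        ≤⟨ u-step s↑ x ⟩
      l * u x ∎
      where
      1≤ : 1# ≤ sum {length F} (λ k → identity (lookup F k) x)
      1≤ = begin
        1#                                  ≈⟨ identity-diagonal x ⟨
        identity x x                        ≡⟨ ≡.cong (λ v → identity v x) (lookup-index x∈F) ⟩
        identity (lookup F (index x∈F)) x   ≤⟨ term≤sum (λ k → identity-nonNeg (lookup F k) x) (index x∈F) ⟩
        sum {length F} (λ k → identity (lookup F k) x) ∎

corollary3 :
  ExcludedMiddle 0ℓ →
  (R : Reals) →
  let open Reals R
      open RealMatrix R
  in
  (M : Matrix) →
  NonNegative M →
  Irreducible M →
  (ls : ℕ → Carrier) (l : Carrier) →
  Isλ M ls l →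
  HasFiniteCycleTransversal M →
  IsLittleO[1/n] (λ n → l - ls n) →
  Recurrent M l
corollary3 em R M 0≤M irreducible ls l isλ transversal little =
  Recurrence.recurrent em R 0≤M irreducible isλ transversal little
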